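{- Consider the equation $$(1+\sqrt{ -D})^r = a \pm \sqrt{ -D},$$ where $D$ and $r$ are positive integers, $a$ is an integer, and the sign $\pm$ may be either sign. (1) If $D$ is a positive integer with $D \equiv 2 \pmod 4$ and $a$ is any integer, then the equation has no solutions with $r>1$, except for $D=2$, $r=3$. (2) If $D$ is a positive integer with $D \equiv 0 \pmod 4$ such that $1+D$ is a prime or a prime power, then the equation has no solutions with $r>1$ (for any integer $a$), except for $D=4$, $r=3$.
   Context: $D$ is not assumed to be squarefree. $\sqrt{ -D}$ denotes a fixed complex square root of $-D$. -}

module Defs where

open import Algebra.Bundles using (CommutativeRing)
open import Data.Integer using (ℤ; +_; -_; 0ℤ; 1ℤ) renaming (_+_ to _+ℤ_; _*_ to _*ℤ_)
open import Data.Integer.Properties using (+-assoc; +-comm; +-identityˡ; +-inverseˡ; *-identityˡ)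
open import Data.Integer.Tactic.RingSolver using (solve-∀)
open import Data.Nat using (ℕ; _≥_; _^_)
open import Data.Nat.Primality using (Prime)
open import Data.Product using (∃-syntax; _,_; _×_)
open import Data.Sum using (_⊎_)
open import Level using (0ℓ)
open import Relation.Binary.PropositionalEquality using (_≡_; refl; cong; cong₂; isEquivalence)
import Algebra.Properties.Semiring.Exp as Exp
open import Algebra.Consequences.Propositional using (comm∧idˡ⇒id; comm∧invˡ⇒inv; comm∧distrˡ⇒distrʳ)

-- ⟨ x , y ⟩ stands for x + y √d.  When d < 0 a complex square root of d is not
-- real, so x and y are determined by the complex number x + y √d.  ℤ[√ d ]
-- is then the subring of ℂ generated by √d, and _≡_ on it is equality in ℂ;
-- d need not be squarefree.
record ℤ[√_] (d : ℤ) : Set where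
  constructor ⟨_,_⟩
  field
    re im : ℤ

module _ {d : ℤ} where

  infixl 6 _⊕_
  infixl 7 _⊗_
  infix  8 ⊖_

  _⊕_ : ℤ[√ d ] → ℤ[√ d ] → ℤ[√ d ]
  ⟨ x , y ⟩ ⊕ ⟨ u , v ⟩ = ⟨ x +ℤ u , y +ℤ v ⟩

  _⊗_ : ℤ[√ d ] → ℤ[√ d ] → ℤ[√ d ]
  ⟨ x , y ⟩ ⊗ ⟨ u , v ⟩ = ⟨ x *ℤ u +ℤ d *ℤ (y *ℤ v) , x *ℤ v +ℤ y *ℤ u ⟩

  ⊖_ : ℤ[√ d ] → ℤ[√ d ]
  ⊖ ⟨ x , y ⟩ = ⟨ - x , - y ⟩

  ι : ℤ → ℤ[√ d ]
  ι n = ⟨ n , 0ℤ ⟩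

  ⊕-comm : ∀ (z w : ℤ[√ d ]) → z ⊕ w ≡ w ⊕ z
  ⊕-comm ⟨ x , y ⟩ ⟨ u , v ⟩ = cong₂ ⟨_,_⟩ (+-comm x u) (+-comm y v)

  ⊗-comm : ∀ (z w : ℤ[√ d ]) → z ⊗ w ≡ w ⊗ z
  ⊗-comm ⟨ x , y ⟩ ⟨ u , v ⟩ = cong₂ ⟨_,_⟩ (eq₁ d x y u v) (eq₂ x y u v)
    where
    eq₁ : ∀ d x y u v → x *ℤ u +ℤ d *ℤ (y *ℤ v) ≡ u *ℤ x +ℤ d *ℤ (v *ℤ y)
    eq₁ = solve-∀
    eq₂ : ∀ x y u v → x *ℤ v +ℤ y *ℤ u ≡ u *ℤ y +ℤ v *ℤ x
    eq₂ = solve-∀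

  ⊗-assoc : ∀ (z w t : ℤ[√ d ]) → (z ⊗ w) ⊗ t ≡ z ⊗ (w ⊗ t)
  ⊗-assoc ⟨ x , y ⟩ ⟨ u , v ⟩ ⟨ s , t ⟩ =
    cong₂ ⟨_,_⟩ (eq₁ d x y u v s t) (eq₂ d x y u v s t)
    where
    eq₁ : ∀ d x y u v s t →
          (x *ℤ u +ℤ d *ℤ (y *ℤ v)) *ℤ s +ℤ d *ℤ ((x *ℤ v +ℤ y *ℤ u) *ℤ t)
          ≡ x *ℤ (u *ℤ s +ℤ d *ℤ (v *ℤ t)) +ℤ d *ℤ (y *ℤ (u *ℤ t +ℤ v *ℤ s))
    eq₁ = solve-∀
    eq₂ : ∀ d x y u v s t →
          (x *ℤ u +ℤ d *ℤ (y *ℤ v)) *ℤ t +ℤ (x *ℤ v +ℤ y *ℤ u) *ℤ s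
          ≡ x *ℤ (u *ℤ t +ℤ v *ℤ s) +ℤ y *ℤ (u *ℤ s +ℤ d *ℤ (v *ℤ t))
    eq₂ = solve-∀

  ⊗-identityˡ : ∀ (z : ℤ[√ d ]) → ι 1ℤ ⊗ z ≡ z
  ⊗-identityˡ ⟨ x , y ⟩ = cong₂ ⟨_,_⟩ (eq₁ d x y) (eq₂ x y)
    where
    eq₁ : ∀ d x y → 1ℤ *ℤ x +ℤ d *ℤ (0ℤ *ℤ y) ≡ x
    eq₁ = solve-∀
    eq₂ : ∀ x y → 1ℤ *ℤ y +ℤ 0ℤ *ℤ x ≡ y
    eq₂ = solve-∀

  ⊗-distribˡ-⊕ : ∀ (z w t : ℤ[√ d ]) → z ⊗ (w ⊕ t) ≡ z ⊗ w ⊕ z ⊗ t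
  ⊗-distribˡ-⊕ ⟨ x , y ⟩ ⟨ u , v ⟩ ⟨ s , t ⟩ =
    cong₂ ⟨_,_⟩ (eq₁ d x y u v s t) (eq₂ x y u v s t)
    where
    eq₁ : ∀ d x y u v s t →
          x *ℤ (u +ℤ s) +ℤ d *ℤ (y *ℤ (v +ℤ t))
          ≡ (x *ℤ u +ℤ d *ℤ (y *ℤ v)) +ℤ (x *ℤ s +ℤ d *ℤ (y *ℤ t))
    eq₁ = solve-∀
    eq₂ : ∀ x y u v s t →
          x *ℤ (v +ℤ t) +ℤ y *ℤ (u +ℤ s)
          ≡ (x *ℤ v +ℤ y *ℤ u) +ℤ (x *ℤ t +ℤ y *ℤ s)
    eq₂ = solve-∀

ℤ[√]-commutativeRing : ℤ → CommutativeRing 0ℓ 0ℓ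
ℤ[√]-commutativeRing d = record
  { Carrier = ℤ[√ d ]
  ; _≈_ = _≡_
  ; _+_ = _⊕_
  ; _*_ = _⊗_
  ; -_ = ⊖_
  ; 0# = ι 0ℤ
  ; 1# = ι 1ℤ
  ; isCommutativeRing = record
    { isRing = record
      { +-isAbelianGroup = record
        { isGroup = record
          { isMonoid = record
            { isSemigroup = record
              { isMagma = record
                { isEquivalence = isEquivalence
                ; ∙-cong = cong₂ _⊕_
                }
              ; assoc = λ (⟨ x , y ⟩) (⟨ u , v ⟩) (⟨ s , t ⟩) →
                  cong₂ ⟨_,_⟩ (+-assoc x u s) (+-assoc y v t)
              }
            ; identity = comm∧idˡ⇒id ⊕-comm λ (⟨ x , y ⟩) →
                cong₂ ⟨_,_⟩ (+-identityˡ x) (+-identityˡ y)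
            }
          ; inverse = comm∧invˡ⇒inv ⊕-comm λ (⟨ x , y ⟩) →
              cong₂ ⟨_,_⟩ (+-inverseˡ x) (+-inverseˡ y)
          ; ⁻¹-cong = cong ⊖_
          }
        ; comm = ⊕-comm
        }
      ; *-cong = cong₂ _⊗_
      ; *-assoc = ⊗-assoc
      ; *-identity = comm∧idˡ⇒id ⊗-comm ⊗-identityˡ
      ; distrib = ⊗-distribˡ-⊕ , comm∧distrˡ⇒distrʳ ⊗-comm ⊗-distribˡ-⊕
      }
    ; *-comm = ⊗-comm
    }
  }

√_ : ∀ d → ℤ[√ d ]
√ d = ⟨ 0ℤ , 1ℤ ⟩

√-square : ∀ d → √ d ⊗ √ d ≡ ι d
√-square d = cong₂ ⟨_,_⟩ (eq d) refl
  where
  eq : ∀ d → 0ℤ *ℤ 0ℤ +ℤ d *ℤ (1ℤ *ℤ 1ℤ) ≡ d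
  eq = solve-∀

IsSolution : ℕ → ℕ → ℤ → Set
IsSolution D r a =
    ((1# + √-D) ^ᵣ r ≡ ι a + √-D)
  ⊎ ((1# + √-D) ^ᵣ r ≡ ι a - √-D)
  where
  open CommutativeRing (ℤ[√]-commutativeRing (- (+ D))) using (1#; _+_; _-_; semiring)
  open Exp semiring using () renaming (_^_ to _^ᵣ_)
  √-D = √ (- (+ D))

IsPrimePower : ℕ → Set
IsPrimePower n = ∃[ p ] ∃[ k ] (Prime p × k ≥ 1 × n ≡ p ^ k)

{-# OPTIONS --safe #-}

module Submission where

-- Write d = −D, α = 1 + √d and Uᵣ for the √d-coefficient of αʳ, so that the
-- equation says Uᵣ = ±1.
--
-- Rigidity is Skolem's p-adic argument: if the √d-coefficient of B (1 + Kγ)ᵐ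
-- equals that of B, with M ∣ K and the √d-coefficient of Bγ invertible modulo
-- M, then M ∣ m; replacing 1 + Kγ by its M-th power and m by m / M, one
-- descends to m = 0.  Since α⁴ ≡ 1 mod 4 for even D, this shows (with M = 2)
-- that Uᵣ = U₁ only for r = 1 when r ≡ 1 mod 4, and Uᵣ = U₃ only for r = 3 when
-- r ≡ 3 mod 4.  For D ≡ 2 mod 4, D ≠ 2, a suitable odd divisor M > 1 of D and
-- the power αᴹ show in the same way that Uᵣ = 1 only for r = 1.
--
-- In the remaining case D ≡ 0 mod 4, r = 2n + 1 ≡ 3 mod 4, Uᵣ = −1 and
-- Q = 1 + D = pᵏ.  From D ∣ r + 1, Q ∣ 2ʳ⁻¹ + 1 and p − 1 ∣ D, Fermat gives
-- 0 ≡ 4 (2ʳ⁻¹ + 1) ≡ 5 mod p, so p = 5.  If k ≥ 2, then 25 ∣ 4ⁿ + 1 gives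
-- 5 ∣ n, hence U₅ ∣ Uₙ; with αⁿ = x + y√d, the equation U₂ₙ₊₁ = −1 shows that
-- y = Uₙ divides x² + 1.  But U₅ = Q² − 12Q + 16 splits when Q is a power of
-- 5, and has a divisor ≡ 3 mod 4.

private module Lucas where

  open import Defs
  open import Algebra.Bundles using (CommutativeRing)
  import Algebra.Properties.Semiring.Exp as Exp
  open import Data.Empty using (⊥; ⊥-elim)
  open import Data.Fin using (zero; suc; toℕ)
  open import Data.Fin.Properties using (toℕ<n)
  open import Data.Integer
    using (ℤ; +_; -[1+_]; -_; 0ℤ; 1ℤ; -1ℤ; _+_; _*_; _-_; ∣_∣; NonZero)
  open import Data.Integer.Divisibility.Signed
    using (_∣_; divides; _∣?_; ∣-refl; ∣-trans; ∣m⇒∣m*n; ∣m+n∣n⇒∣m; ∣⇒∣ᵤ)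
  open import Data.Integer.Properties
    using (*-cancelˡ-≡; *-zeroʳ; +-identityʳ; i*j≢0; pos-*)
  open import Data.Integer.Tactic.RingSolver using (solve-∀)
  import Data.Nat as ℕ
  open import Data.Nat using (ℕ; zero; suc; _^_; _!; _/_; _%_; _>_; s≤s; z≤n)
  open import Data.Nat.Combinatorics
    using (_C_; nCn≡1; k>n⇒nCk≡0; nCk≡n!/k![n-k]!; k![n∸k]!∣n!; nCk+nC[k+1]≡[n+1]C[k+1])
  import Data.Nat.Divisibility as ℕ
  open import Data.Nat.DivMod
    using (DivMod; _divMod_; result; m/n*n≡m; m≡m%n+[m/n]*n; [m+kn]%n≡m%n)
  open import Data.Nat.Induction using (<-wellFounded)
  open import Data.Nat.Primality
    using (Prime; prime?; euclidsLemma; prime⇒irreducible; prime⇒nonTrivial; ¬prime[0]; ¬prime[1])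
  import Data.Nat.Properties as ℕ
  import Data.Nat.Tactic.RingSolver as ℕ
  open import Data.Product using (∃-syntax; _×_; _,_; proj₁; proj₂)
  open import Data.Sum using (_⊎_; inj₁; inj₂)
  open import Induction.WellFounded using (Acc; acc)
  open import Relation.Binary.PropositionalEquality
    using (_≡_; refl; sym; trans; cong; cong₂; subst; module ≡-Reasoning)
  open import Relation.Nullary using (¬_)
  open import Relation.Nullary.Decidable using (from-no; from-yes)

  -- -1 is not a square modulo 3 + 4t.

  -- Since `2v + 1 ≤ m`, the number `4v² + 1` lies below `(2v + 1) m ≤ m²`. This bound makes the
  -- descent on the cofactor terminate.
  c*m≡4v²+1⇒c<m : ∀ {c v m} → 3 ℕ.≤ m → 2 ℕ.* v ℕ.< m → c ℕ.* m ≡ 2 ℕ.* v ℕ.* (2 ℕ.* v) ℕ.+ 1 → c ℕ.< m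
  c*m≡4v²+1⇒c<m {c} {v} {m} 3≤m 2v<m eq = ℕ.≰⇒> λ m≤c → ℕ.<-irrefl refl (begin-strict
    c ℕ.* m                                   ≡⟨ eq ⟩
    2 ℕ.* v ℕ.* (2 ℕ.* v) ℕ.+ 1               <⟨ ℕ.+-monoʳ-< (2 ℕ.* v ℕ.* (2 ℕ.* v)) (ℕ.≤-trans (s≤s (s≤s z≤n)) 3≤m) ⟩
    2 ℕ.* v ℕ.* (2 ℕ.* v) ℕ.+ m               ≤⟨ ℕ.+-monoˡ-≤ m (ℕ.*-monoʳ-≤ (2 ℕ.* v) (ℕ.<⇒≤ 2v<m)) ⟩
    2 ℕ.* v ℕ.* m ℕ.+ m                       ≡⟨ ℕ.+-comm (2 ℕ.* v ℕ.* m) m ⟩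
    suc (2 ℕ.* v) ℕ.* m                       ≤⟨ ℕ.*-monoˡ-≤ m (ℕ.≤-trans 2v<m m≤c) ⟩
    c ℕ.* m                                   ∎)
    where open ℕ.≤-Reasoning

  -- As m is odd, the residue of x or of −x modulo m is even.
  even-root : ∀ t x → + (3 ℕ.+ 4 ℕ.* t) ∣ + x * + x + 1ℤ →
    ∃[ v ] 2 ℕ.* v ℕ.< 3 ℕ.+ 4 ℕ.* t × 3 ℕ.+ 4 ℕ.* t ℕ.∣ 2 ℕ.* v ℕ.* (2 ℕ.* v) ℕ.+ 1
  even-root t x (divides c x²+1≡cm) = by-parity (x divMod m)
    where
    m = 3 ℕ.+ 4 ℕ.* t
    congruent : ∀ (z k : ℤ) → z ≡ + x + k * + m ⊎ z ≡ - + x + k * + m → + m ∣ z * z + 1ℤ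
    congruent z k (inj₁ refl) = divides (c + (+ 2 * + x + k * + m) * k) (trans
        (e₁ (+ x) k (+ m)) (trans (cong (_+ (+ 2 * + x + k * + m) * (k * + m)) x²+1≡cm) (e₂ c (+ 2 * + x + k * + m) k (+ m))))
      where
      e₁ : ∀ x k m → (x + k * m) * (x + k * m) + 1ℤ ≡ x * x + 1ℤ + (+ 2 * x + k * m) * (k * m)
      e₁ = solve-∀
      e₂ : ∀ c y k m → c * m + y * (k * m) ≡ (c + y * k) * m
      e₂ = solve-∀
    congruent z k (inj₂ refl) = subst (+ m ∣_) (e (+ x) k (+ m)) (congruent (+ x + - k * + m) (- k) (inj₁ refl))
      where
      e : ∀ x k m → (x + - k * m) * (x + - k * m) + 1ℤ ≡ (- x + k * m) * (- x + k * m) + 1ℤ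
      e = solve-∀
    congruent-ℕ : ∀ z k → + z ≡ + x + k * + m ⊎ + z ≡ - + x + k * + m → m ℕ.∣ z ℕ.* z ℕ.+ 1
    congruent-ℕ z k z≡ = ∣⇒∣ᵤ (subst (λ y → + m ∣ y + 1ℤ) (sym (pos-* z z)) (congruent (+ z) k z≡))
    by-parity : DivMod x m → ∃[ v ] 2 ℕ.* v ℕ.< m × m ℕ.∣ 2 ℕ.* v ℕ.* (2 ℕ.* v) ℕ.+ 1
    by-parity (result q r x≡) with toℕ r divMod 2
    ... | result w zero r≡ = w , subst (ℕ._< m) r≡2w (toℕ<n r) ,
        congruent-ℕ (2 ℕ.* w) (- + q) (inj₁ (e (+ (2 ℕ.* w)) (+ q) (+ m) (trans (cong +_ x≡)
          (cong₂ (λ a b → + a + b) r≡2w (pos-* q m)))))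
      where
      r≡2w : toℕ r ≡ 2 ℕ.* w
      r≡2w = trans r≡ (ℕ.*-comm w 2)
      e : ∀ {x} z q m → x ≡ z + q * m → z ≡ x + - q * m
      e z q m refl = e′ z q m
        where
        e′ : ∀ z q m → z ≡ z + q * m + - q * m
        e′ = solve-∀
    ... | result w (suc zero) r≡ = v , 2v<m ,
        congruent-ℕ (2 ℕ.* v) (1ℤ + + q) (inj₂ (e (+ (2 ℕ.* v)) (+ toℕ r) (+ q) (+ m) (trans (cong +_ x≡)
          (cong (λ b → + toℕ r + b) (pos-* q m))) (cong +_ r+2v≡m)))
      where
      r≡1+2w : toℕ r ≡ 1 ℕ.+ 2 ℕ.* w
      r≡1+2w = trans r≡ (cong suc (ℕ.*-comm w 2))
      w≤ : w ℕ.≤ 1 ℕ.+ 2 ℕ.* t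
      w≤ = ℕ.*-cancelˡ-≤ 2 (begin
        2 ℕ.* w              ≤⟨ ℕ.n≤1+n _ ⟩
        1 ℕ.+ 2 ℕ.* w        ≡⟨ r≡1+2w ⟨
        toℕ r                ≤⟨ ℕ.≤-pred (toℕ<n r) ⟩
        2 ℕ.+ 4 ℕ.* t        ≡⟨ e t ⟩
        2 ℕ.* (1 ℕ.+ 2 ℕ.* t) ∎)
        where
        open ℕ.≤-Reasoning
        e : ∀ t → 2 ℕ.+ 4 ℕ.* t ≡ 2 ℕ.* (1 ℕ.+ 2 ℕ.* t)
        e = ℕ.solve-∀
      -- `m` minus the odd residue `1 + 2w` is `2 (1 + 2t − w)`, an even representative of `−x`; by
      -- `w≤` the truncated subtraction is exact.
      v = 1 ℕ.+ 2 ℕ.* t ℕ.∸ w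
      r+2v≡m : toℕ r ℕ.+ 2 ℕ.* v ≡ m
      r+2v≡m = begin
        toℕ r ℕ.+ 2 ℕ.* v             ≡⟨ cong (ℕ._+ 2 ℕ.* v) r≡1+2w ⟩
        1 ℕ.+ 2 ℕ.* w ℕ.+ 2 ℕ.* v     ≡⟨ e₁ w v ⟩
        1 ℕ.+ 2 ℕ.* (w ℕ.+ v)         ≡⟨ cong (λ y → 1 ℕ.+ 2 ℕ.* y) (ℕ.m+[n∸m]≡n w≤) ⟩
        1 ℕ.+ 2 ℕ.* (1 ℕ.+ 2 ℕ.* t)   ≡⟨ e₂ t ⟩
        m                             ∎
        where
        open ≡-Reasoning
        e₁ : ∀ w v → 1 ℕ.+ 2 ℕ.* w ℕ.+ 2 ℕ.* v ≡ 1 ℕ.+ 2 ℕ.* (w ℕ.+ v)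
        e₁ = ℕ.solve-∀
        e₂ : ∀ t → 1 ℕ.+ 2 ℕ.* (1 ℕ.+ 2 ℕ.* t) ≡ 3 ℕ.+ 4 ℕ.* t
        e₂ = ℕ.solve-∀
      2v<m : 2 ℕ.* v ℕ.< m
      2v<m = subst (2 ℕ.* v ℕ.<_) (trans (cong (ℕ._+ 2 ℕ.* v) (sym r≡1+2w)) r+2v≡m) (s≤s (ℕ.m≤n+m (2 ℕ.* v) (2 ℕ.* w)))
      e : ∀ {x} z r q m → x ≡ r + q * m → r + z ≡ m → z ≡ - x + (1ℤ + q) * m
      e z r q _ refl refl = e′ z r q
        where
        e′ : ∀ z r q → z ≡ - (r + q * (r + z)) + (1ℤ + q) * (r + z)
        e′ = solve-∀

  %4-cong : ∀ {a b} k l → a ℕ.+ k ℕ.* 4 ≡ b ℕ.+ l ℕ.* 4 → a ℕ.% 4 ≡ b ℕ.% 4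
  %4-cong {a} {b} k l eq = trans (sym ([m+kn]%n≡m%n a k 4)) (trans (cong (ℕ._% 4) eq) ([m+kn]%n≡m%n b l 4))

  -- Descent: the cofactor of 3+4t in 4v²+1 is again 3 mod 4, and smaller.
  3+4t∤x²+1 : ∀ t x → ¬ + (3 ℕ.+ 4 ℕ.* t) ∣ + x * + x + 1ℤ
  3+4t∤x²+1 t = go t (<-wellFounded t)
    where
    go : ∀ t → Acc ℕ._<_ t → ∀ x → ¬ + (3 ℕ.+ 4 ℕ.* t) ∣ + x * + x + 1ℤ
    go t (acc rs) x m∣ with even-root t x m∣
    ... | v , 2v<m , ℕ.divides c eq = by-residue (c divMod 4)
      where
      m = 3 ℕ.+ 4 ℕ.* t
      -- Modulo 4 the equation `c m = 4v² + 1` reads `3c ≡ 1`, so only `c ≡ 3` survives.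
      residue : ∀ r s → c ≡ r ℕ.+ s ℕ.* 4 → 1 ≡ (r ℕ.* 3) ℕ.% 4
      residue r s refl = %4-cong (v ℕ.* v) (r ℕ.* t ℕ.+ s ℕ.* m) (trans (e₁ v) (trans eq (e₂ r s t)))
        where
        e₁ : ∀ v → 1 ℕ.+ v ℕ.* v ℕ.* 4 ≡ 2 ℕ.* v ℕ.* (2 ℕ.* v) ℕ.+ 1
        e₁ = ℕ.solve-∀
        e₂ : ∀ r s t → (r ℕ.+ s ℕ.* 4) ℕ.* (3 ℕ.+ 4 ℕ.* t) ≡ r ℕ.* 3 ℕ.+ (r ℕ.* t ℕ.+ s ℕ.* (3 ℕ.+ 4 ℕ.* t)) ℕ.* 4
        e₂ = ℕ.solve-∀
      by-residue : DivMod c 4 → ⊥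
      by-residue (result s zero c≡) with () ← residue 0 s c≡
      by-residue (result s (suc zero) c≡) with () ← residue 1 s c≡
      by-residue (result s (suc (suc zero)) c≡) with () ← residue 2 s c≡
      by-residue (result s (suc (suc (suc zero))) c≡) = go s (rs s<t) (2 ℕ.* v)
        (divides (+ m) (begin
          + (2 ℕ.* v) * + (2 ℕ.* v) + 1ℤ    ≡⟨ cong (_+ 1ℤ) (pos-* (2 ℕ.* v) (2 ℕ.* v)) ⟨
          + (2 ℕ.* v ℕ.* (2 ℕ.* v) ℕ.+ 1)   ≡⟨ cong +_ (trans eq (trans (ℕ.*-comm c m) (cong (m ℕ.*_) c≡3+4s))) ⟩
          + (m ℕ.* (3 ℕ.+ 4 ℕ.* s))         ≡⟨ pos-* m (3 ℕ.+ 4 ℕ.* s) ⟩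
          + m * + (3 ℕ.+ 4 ℕ.* s)           ∎))
        where
        open ≡-Reasoning
        c≡3+4s : c ≡ 3 ℕ.+ 4 ℕ.* s
        c≡3+4s = trans c≡ (cong (3 ℕ.+_) (ℕ.*-comm s 4))
        s<t : s ℕ.< t
        s<t = ℕ.*-cancelˡ-< 4 s t (ℕ.+-cancelˡ-< 3 (4 ℕ.* s) (4 ℕ.* t) (subst (ℕ._< m) c≡3+4s
          (c*m≡4v²+1⇒c<m {c} {v} {m} (s≤s (s≤s (s≤s z≤n))) 2v<m (sym eq))))

  -- Fermat's little theorem to the base 2.

  prime∤! : ∀ {p} → Prime p → ∀ k → k ℕ.< p → ¬ p ℕ.∣ k !
  prime∤! {p} pr zero    k<p p∣ = ℕ.<⇒≱ (ℕ.nonTrivial⇒n>1 p {{prime⇒nonTrivial pr}}) (ℕ.∣⇒≤ p∣)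
  prime∤! {p} pr (suc k) k<p p∣ with euclidsLemma (suc k) (k !) pr p∣
  ... | inj₁ p∣k = ℕ.<⇒≱ k<p (ℕ.∣⇒≤ p∣k)
  ... | inj₂ p∣k! = prime∤! pr k (ℕ.<-trans (ℕ.n<1+n k) k<p) p∣k!

  C*!*! : ∀ {n k} → k ℕ.≤ n → (n C k) ℕ.* (k ! ℕ.* (n ℕ.∸ k) !) ≡ n !
  C*!*! {n} {k} k≤n = trans (cong (ℕ._* (k ! ℕ.* (n ℕ.∸ k) !)) (nCk≡n!/k![n-k]! k≤n))
    (m/n*n≡m {{k ℕ.!* (n ℕ.∸ k) !≢0}} (k![n∸k]!∣n! k≤n))

  -- The prime divides `p !`, the product of the binomial coefficient and two factorials of smaller
  -- numbers, and it divides neither factorial.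
  prime∣C : ∀ {p} → Prime p → ∀ k → suc k ℕ.< p → p ℕ.∣ p C suc k
  prime∣C {p@(suc p′)} pr k k<p
    with euclidsLemma (p C suc k) (suc k ! ℕ.* (p ℕ.∸ suc k) !) pr
           (subst (p ℕ.∣_) (sym (C*!*! (ℕ.<⇒≤ k<p))) (ℕ.m∣m*n (p′ !)))
  ... | inj₁ p∣C = p∣C
  ... | inj₂ p∣!! with euclidsLemma (suc k !) _ pr p∣!!
  ...   | inj₁ p∣! = ⊥-elim (prime∤! pr (suc k) k<p p∣!)
  ...   | inj₂ p∣! = ⊥-elim (prime∤! pr (p ℕ.∸ suc k) (ℕ.∸-monoʳ-< (s≤s z≤n) (ℕ.<⇒≤ k<p)) p∣!)

  -- Partial row sums of Pascal's triangle with an exclusive upper bound: `ΣC p p` stops just before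
  -- the last entry `p C p`, which is 1.
  ΣC : ℕ → ℕ → ℕ
  ΣC n zero    = 0
  ΣC n (suc k) = ΣC n k ℕ.+ n C k

  ΣC-pascal : ∀ n k → ΣC (suc n) (suc k) ≡ ΣC n (suc k) ℕ.+ ΣC n k
  ΣC-pascal n zero    = refl
  ΣC-pascal n (suc k) = begin
    ΣC (suc n) (suc k) ℕ.+ suc n C suc k                     ≡⟨ cong₂ ℕ._+_ (ΣC-pascal n k) (sym (nCk+nC[k+1]≡[n+1]C[k+1] n k)) ⟩
    ΣC n (suc k) ℕ.+ ΣC n k ℕ.+ (n C k ℕ.+ n C suc k)        ≡⟨ e (ΣC n (suc k)) (ΣC n k) (n C k) (n C suc k) ⟩
    ΣC n (suc k) ℕ.+ n C suc k ℕ.+ (ΣC n k ℕ.+ n C k)        ∎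
    where
    open ≡-Reasoning
    e : ∀ a b c d → a ℕ.+ b ℕ.+ (c ℕ.+ d) ≡ a ℕ.+ d ℕ.+ (b ℕ.+ c)
    e = ℕ.solve-∀

  ΣC≡2^ : ∀ n → ΣC n (suc n) ≡ 2 ^ n
  ΣC≡2^ zero    = refl
  ΣC≡2^ (suc n) = begin
    ΣC (suc n) (suc (suc n))                            ≡⟨ ΣC-pascal n (suc n) ⟩
    ΣC n (suc n) ℕ.+ n C suc n ℕ.+ ΣC n (suc n)         ≡⟨ cong (λ x → ΣC n (suc n) ℕ.+ x ℕ.+ ΣC n (suc n)) (k>n⇒nCk≡0 (ℕ.n<1+n n)) ⟩
    ΣC n (suc n) ℕ.+ 0 ℕ.+ ΣC n (suc n)                 ≡⟨ cong (λ x → x ℕ.+ 0 ℕ.+ x) (ΣC≡2^ n) ⟩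
    2 ^ n ℕ.+ 0 ℕ.+ 2 ^ n                               ≡⟨ e (2 ^ n) ⟩
    2 ^ suc n                                           ∎
    where
    open ≡-Reasoning
    e : ∀ x → x ℕ.+ 0 ℕ.+ x ≡ 2 ℕ.* x
    e = ℕ.solve-∀

  prime∣ΣC-1 : ∀ {p} → Prime p → ∀ k → k ℕ.< p → ∃[ c ] ΣC p (suc k) ≡ 1 ℕ.+ c ℕ.* p
  prime∣ΣC-1 pr zero    _   = 0 , refl
  prime∣ΣC-1 {p} pr (suc k) k<p with prime∣ΣC-1 pr k (ℕ.<-trans (ℕ.n<1+n k) k<p) | prime∣C pr k k<p
  ... | a , Σ≡ | ℕ.divides b C≡ = a ℕ.+ b , trans (cong₂ ℕ._+_ Σ≡ C≡) (e a b p)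
    where
    e : ∀ a b p → 1 ℕ.+ a ℕ.* p ℕ.+ b ℕ.* p ≡ 1 ℕ.+ (a ℕ.+ b) ℕ.* p
    e = ℕ.solve-∀

  -- In row `p` of Pascal's triangle the two ends contribute 2, and `p` divides every other entry.
  fermat-2 : ∀ {p} → Prime p → ∃[ c ] 2 ^ p ≡ 2 ℕ.+ c ℕ.* p
  fermat-2 {suc p} pr with prime∣ΣC-1 pr p (ℕ.n<1+n p)
  ... | c , Σ≡ = c , (begin
    2 ^ suc p                             ≡⟨ ΣC≡2^ (suc p) ⟨
    ΣC (suc p) (suc p) ℕ.+ suc p C suc p  ≡⟨ cong₂ ℕ._+_ Σ≡ (nCn≡1 (suc p)) ⟩
    1 ℕ.+ c ℕ.* suc p ℕ.+ 1               ≡⟨ ℕ.+-comm (1 ℕ.+ c ℕ.* suc p) 1 ⟩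
    2 ℕ.+ c ℕ.* suc p                     ∎)
    where open ≡-Reasoning

  open ≡-Reasoning

  -- Binomial expansions in ℤ[√d].

  module _ {d : ℤ} where
    open Exp (CommutativeRing.semiring (ℤ[√]-commutativeRing d)) public
      using (^-homo-*; ^-assocʳ) renaming (_^_ to _^ᵣ_)

  open ℤ[√_] public using (im)

  infixr 6.5 _·_
  _·_ : ∀ {d} → ℤ → ℤ[√ d ] → ℤ[√ d ]
  k · ⟨ x , y ⟩ = ⟨ k * x , k * y ⟩

  𝟙 : ∀ {d} → ℤ[√ d ]
  𝟙 = ι 1ℤ

  α : ∀ d → ℤ[√ d ]
  α d = ⟨ 1ℤ , 1ℤ ⟩

  -- The binomial coefficients n C 2 and n C 3.
  tri tet : ℕ → ℕ
  tri zero    = 0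
  tri (suc n) = tri n ℕ.+ n
  tet zero    = 0
  tet (suc n) = tet n ℕ.+ tri n

  -- The binomial theorem modulo K³. The quadratic coefficient stays explicit because it decides how
  -- well an M-th power is approximated, and for M = 2 it is only 1.
  expand₃ : ∀ {d} K (γ : ℤ[√ d ]) n → ∃[ w ]
    (𝟙 ⊕ K · γ) ^ᵣ n ≡ 𝟙 ⊕ (+ n) * K · γ ⊕ (+ tri n) * (K * K) · (γ ⊗ γ) ⊕ K * K * K · w
  expand₃ {d} K ⟨ g , h ⟩ zero = ⟨ 0ℤ , 0ℤ ⟩ , cong₂ ⟨_,_⟩ (e₁ K g (g * g + d * (h * h))) (e₂ K h (g * h + h * g))
    where
    e₁ : ∀ K g s → 1ℤ ≡ 1ℤ + 0ℤ * K * g + 0ℤ * (K * K) * s + K * K * K * 0ℤ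
    e₁ = solve-∀
    e₂ : ∀ K g s → 0ℤ ≡ 0ℤ + 0ℤ * K * g + 0ℤ * (K * K) * s + K * K * K * 0ℤ
    e₂ = solve-∀
  expand₃ {d} K γ@(⟨ g , h ⟩) (suc n) with expand₃ K γ n
  ... | ⟨ u , v ⟩ , eq = w′ , trans (cong ((𝟙 ⊕ K · γ) ⊗_) eq)
      (cong₂ ⟨_,_⟩ (e₁ d K g h u v (+ n) (+ tri n)) (e₂ d K g h u v (+ n) (+ tri n)))
    where
    -- The new terms of degree at least three in K, divided by K³: the old remainder, `K · γ` times
    -- the quadratic term, and `K · γ` times the old remainder.
    w′ = ⟨ u , v ⟩ ⊕ (+ tri n) · (γ ⊗ (γ ⊗ γ)) ⊕ K · (γ ⊗ ⟨ u , v ⟩)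
    e₁ : ∀ d K g h u v n t →
      (1ℤ + K * g) * (1ℤ + n * K * g + t * (K * K) * (g * g + d * (h * h)) + K * K * K * u)
        + d * ((0ℤ + K * h) * (0ℤ + n * K * h + t * (K * K) * (g * h + h * g) + K * K * K * v))
      ≡ 1ℤ + (1ℤ + n) * K * g + (t + n) * (K * K) * (g * g + d * (h * h))
        + K * K * K * (u + t * (g * (g * g + d * (h * h)) + d * (h * (g * h + h * g))) + K * (g * u + d * (h * v)))
    e₁ = solve-∀
    e₂ : ∀ d K g h u v n t →
      (1ℤ + K * g) * (0ℤ + n * K * h + t * (K * K) * (g * h + h * g) + K * K * K * v)
        + (0ℤ + K * h) * (1ℤ + n * K * g + t * (K * K) * (g * g + d * (h * h)) + K * K * K * u)
      ≡ 0ℤ + (1ℤ + n) * K * h + (t + n) * (K * K) * (g * h + h * g)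
        + K * K * K * (v + t * (g * (g * h + h * g) + h * (g * g + d * (h * h))) + K * (g * v + h * u))
    e₂ = solve-∀

  -- The binomial terms of degree at least four in √d are absorbed into `d * d`. At `n = M` with
  -- `M ∣ d` this gives αᴹ modulo M².
  α-expand : ∀ d n → ∃[ a ] ∃[ b ]
    α d ^ᵣ n ≡ ⟨ 1ℤ + d * + tri n + d * d * a , + n + d * + tet n + d * d * b ⟩
  α-expand d zero = 0ℤ , 0ℤ , cong₂ ⟨_,_⟩ (e₁ d) (e₂ d)
    where
    e₁ : ∀ d → 1ℤ ≡ 1ℤ + d * 0ℤ + d * d * 0ℤ
    e₁ = solve-∀
    e₂ : ∀ d → 0ℤ ≡ 0ℤ + d * 0ℤ + d * d * 0ℤ
    e₂ = solve-∀
  α-expand d (suc n) with α-expand d n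
  ... | a , b , eq = a + + tet n + d * b , a + b ,
      trans (cong (α d ⊗_) eq)
        (cong₂ ⟨_,_⟩ (e₁ d a b (+ n) (+ tri n) (+ tet n)) (e₂ d a b (+ n) (+ tri n) (+ tet n)))
    where
    e₁ : ∀ d a b n t e → 1ℤ * (1ℤ + d * t + d * d * a) + d * (1ℤ * (n + d * e + d * d * b))
         ≡ 1ℤ + d * (t + n) + d * d * (a + e + d * b)
    e₁ = solve-∀
    e₂ : ∀ d a b n t e → 1ℤ * (n + d * e + d * d * b) + 1ℤ * (1ℤ + d * t + d * d * a)
         ≡ 1ℤ + n + d * (e + t) + d * d * (a + b)
    e₂ = solve-∀

  -- Skolem's p-adic argument.

  infix 4 _InvertibleMod_
  -- A Bézout identity, which allows composite moduli and adapts explicitly when u changes by a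
  -- multiple of M.
  _InvertibleMod_ : ℤ → ℤ → Set
  u InvertibleMod M = ∃[ s ] ∃[ t ] s * u + t * M ≡ 1ℤ

  invertible-shift : ∀ {u v M} q → v ≡ u + M * q → u InvertibleMod M → v InvertibleMod M
  invertible-shift {u} {v} {M} q refl (s , t , eq) = s , t - s * q , trans (e s t u M q) eq
    where
    e : ∀ s t u M q → s * (u + M * q) + (t - s * q) * M ≡ s * u + t * M
    e = solve-∀

  invertible-∣ : ∀ {u M k} → u InvertibleMod M → M ∣ k * u → M ∣ k
  invertible-∣ {u} {M} {k} (s , t , eq) (divides q ku≡qM) = divides (s * q + t * k) (begin
    k                         ≡⟨ e₁ k ⟩
    k * 1ℤ                    ≡⟨ cong (k *_) eq ⟨
    k * (s * u + t * M)       ≡⟨ e₂ k s t u M ⟩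
    s * (k * u) + t * k * M   ≡⟨ cong (λ x → s * x + t * k * M) ku≡qM ⟩
    s * (q * M) + t * k * M   ≡⟨ e₃ s t q M k ⟩
    (s * q + t * k) * M       ∎)
    where
    e₁ : ∀ k → k ≡ k * 1ℤ
    e₁ = solve-∀
    e₂ : ∀ k s t u M → k * (s * u + t * M) ≡ s * (k * u) + t * k * M
    e₂ = solve-∀
    e₃ : ∀ s t q M k → s * (q * M) + t * k * M ≡ (s * q + t * k) * M
    e₃ = solve-∀

  i+j≡i⇒j≡0 : ∀ {i j : ℤ} → i + j ≡ i → j ≡ 0ℤ
  i+j≡i⇒j≡0 {i} {j} eq = begin
    j           ≡⟨ e₁ i j ⟩
    i + j - i   ≡⟨ cong (_- i) eq ⟩
    i - i       ≡⟨ e₂ i ⟩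
    0ℤ          ∎
    where
    e₁ : ∀ i j → j ≡ i + j - i
    e₁ = solve-∀
    e₂ : ∀ i → i - i ≡ 0ℤ
    e₂ = solve-∀

  -- If the left side equals `im B` and K ≠ 0, cancelling K leaves `n * im (B ⊗ γ)` ≡ 0 modulo K.
  im-expand : ∀ {d} (B : ℤ[√ d ]) K γ n → ∃[ x ]
    im (B ⊗ (𝟙 ⊕ K · γ) ^ᵣ n) ≡ im B + K * (+ n * im (B ⊗ γ) + K * x)
  im-expand {d} B@(⟨ b , c ⟩) K γ@(⟨ g , h ⟩) n =
    let w@(⟨ u , v ⟩) , pow = expand₃ K γ n in
    + tri n * im (B ⊗ (γ ⊗ γ)) + K * im (B ⊗ w) ,
      trans (cong (λ z → im (B ⊗ z)) pow) (e d K g h u v (+ n) (+ tri n) b c)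
    where
    e : ∀ d K g h u v n t b c →
      b * (0ℤ + n * K * h + t * (K * K) * (g * h + h * g) + K * K * K * v)
        + c * (1ℤ + n * K * g + t * (K * K) * (g * g + d * (h * h)) + K * K * K * u)
      ≡ c + K * (n * (b * h + c * g)
          + K * (t * (b * (g * h + h * g) + c * (g * g + d * (h * h))) + K * (b * v + c * u)))
    e = solve-∀

  module _ {d : ℤ} (B : ℤ[√ d ]) (M : ℕ) (1<M : 1 ℕ.< M) where

    private instance
      M≢0 : ℕ.NonZero M
      M≢0 = ℕ.>-nonZero (ℕ.<-trans (s≤s z≤n) 1<M)

    exponent-divisible : ∀ m K (γ : ℤ[√ d ]) .{{_ : NonZero K}} → + M ∣ K →
      im (B ⊗ γ) InvertibleMod + M → im (B ⊗ (𝟙 ⊕ K · γ) ^ᵣ m) ≡ im B → + M ∣ + m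
    exponent-divisible m K γ (divides q K≡qM) inv eq =
      invertible-∣ inv (divides (- X * q) (begin
        + m * im (B ⊗ γ)                  ≡⟨ e₁ (+ m * im (B ⊗ γ)) K X ⟩
        + m * im (B ⊗ γ) + K * X - X * K  ≡⟨ cong (_- X * K) vanish ⟩
        0ℤ - X * K                        ≡⟨ cong (λ k → 0ℤ - X * k) K≡qM ⟩
        0ℤ - X * (q * + M)                ≡⟨ e₂ X q (+ M) ⟩
        - X * q * + M                     ∎))
      where
      e₁ : ∀ y K X → y ≡ y + K * X - X * K
      e₁ = solve-∀
      e₂ : ∀ X q M → 0ℤ - X * (q * M) ≡ - X * q * M
      e₂ = solve-∀
      X = proj₁ (im-expand B K γ m)
      vanish : + m * im (B ⊗ γ) + K * X ≡ 0ℤ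
      vanish = *-cancelˡ-≡ K _ _ (trans
        (i+j≡i⇒j≡0 (trans (sym (proj₂ (im-expand B K γ m))) eq)) (sym (*-zeroʳ K)))

    -- In the expansion of the M-th power, the quadratic term is a multiple of K M² by the second
    -- hypothesis, and the cubic one because M² ∣ K². For odd M the second hypothesis follows from
    -- `M ∣ K`, as M ∣ `tri M`; for M = 2 it asks for 4 ∣ K.
    one-plus-pow : ∀ K (γ : ℤ[√ d ]) → + M ∣ K → + M * + M ∣ + tri M * K →
      ∃[ δ ] (𝟙 ⊕ K · γ) ^ᵣ M ≡ 𝟙 ⊕ K * + M · (γ ⊕ + M · δ)
    one-plus-pow K γ M∣K M²∣tK with expand₃ K γ M
    one-plus-pow K γ@(⟨ g , h ⟩) (divides q refl) (divides p tK≡pM²) | w@(⟨ u , v ⟩) , pow =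
      p · (γ ⊗ γ) ⊕ q * q · w , trans pow (cong₂ ⟨_,_⟩
        (e 1ℤ g (g * g + d * (h * h)) u) (e 0ℤ h (g * h + h * g) v))
      where
      e₁ : ∀ o q M g s u t → o + M * (q * M) * g + t * (q * M * (q * M)) * s + q * M * (q * M) * (q * M) * u
           ≡ o + M * (q * M) * g + t * (q * M) * (q * M) * s + q * M * (q * M) * (q * M) * u
      e₁ = solve-∀
      e₂ : ∀ o q M g s u p → o + M * (q * M) * g + p * (M * M) * (q * M) * s + q * M * (q * M) * (q * M) * u
           ≡ o + q * M * M * (g + M * (p * s + q * q * u))
      e₂ = solve-∀
      e : ∀ o g s u → o + + M * K * g + + tri M * (K * K) * s + K * K * K * u
          ≡ o + K * + M * (g + + M * (p * s + q * q * u))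
      e o g s u = trans (e₁ o q (+ M) g s u (+ tri M)) (trans
        (cong (λ x → o + + M * K * g + x * K * s + K * K * K * u) tK≡pM²) (e₂ o q (+ M) g s u p))

    -- The new γ differs from the old one by a multiple of M, so `im (B ⊗ γ)` keeps its residue and
    -- all hypotheses pass to K M and m / M.
    skolem : ∀ m K (γ : ℤ[√ d ]) .{{_ : NonZero K}} → + M ∣ K → + M * + M ∣ + tri M * K →
      im (B ⊗ γ) InvertibleMod + M → im (B ⊗ (𝟙 ⊕ K · γ) ^ᵣ m) ≡ im B → m ≡ 0
    skolem m = go m (<-wellFounded m)
      where
      go : ∀ m → Acc ℕ._<_ m → ∀ K (γ : ℤ[√ d ]) .{{_ : NonZero K}} → + M ∣ K → + M * + M ∣ + tri M * K →
        im (B ⊗ γ) InvertibleMod + M → im (B ⊗ (𝟙 ⊕ K · γ) ^ᵣ m) ≡ im B → m ≡ 0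
      go zero _ _ _ _ _ _ _ = refl
      go m@(suc _) (acc rs) K γ M∣K M²∣tK inv eq =
        descend (∣⇒∣ᵤ (exponent-divisible m K γ M∣K inv eq)) (one-plus-pow K γ M∣K M²∣tK)
        where
        e₁ : ∀ t K M → t * K * M ≡ t * (K * M)
        e₁ = solve-∀
        e₂ : ∀ b c g h u v M → b * (h + M * v) + c * (g + M * u) ≡ b * h + c * g + M * (b * v + c * u)
        e₂ = solve-∀
        shift : ∀ (B γ δ : ℤ[√ d ]) → im (B ⊗ (γ ⊕ + M · δ)) ≡ im (B ⊗ γ) + + M * im (B ⊗ δ)
        shift ⟨ b , c ⟩ ⟨ g , h ⟩ ⟨ u , v ⟩ = e₂ b c g h u v (+ M)

        descend : M ℕ.∣ m → (∃[ δ ] (𝟙 ⊕ K · γ) ^ᵣ M ≡ 𝟙 ⊕ K * + M · (γ ⊕ + M · δ)) → m ≡ 0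
        descend (ℕ.divides m′@(suc _) m≡m′M) (δ , pow) =
          trans m≡m′M (cong (ℕ._* M) (go m′ (rs m′<m) (K * + M) (γ ⊕ + M · δ) {{i*j≢0 K (+ M)}}
            (∣m⇒∣m*n (+ M) M∣K)
            (subst (+ M * + M ∣_) (e₁ (+ tri M) K (+ M)) (∣m⇒∣m*n (+ M) M²∣tK))
            (invertible-shift (im (B ⊗ δ)) (shift B γ δ) inv)
            (trans (cong (λ z → im (B ⊗ z)) same-pow) eq)))
          where
          m′<m : m′ ℕ.< m
          m′<m = subst (m′ ℕ.<_) (sym m≡m′M) (ℕ.m<m*n m′ M 1<M)
          same-pow : (𝟙 ⊕ K * + M · (γ ⊕ + M · δ)) ^ᵣ m′ ≡ (𝟙 ⊕ K · γ) ^ᵣ m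
          same-pow = begin
            (𝟙 ⊕ K * + M · (γ ⊕ + M · δ)) ^ᵣ m′  ≡⟨ cong (_^ᵣ m′) pow ⟨
            ((𝟙 ⊕ K · γ) ^ᵣ M) ^ᵣ m′             ≡⟨ ^-assocʳ (𝟙 ⊕ K · γ) M m′ ⟩
            (𝟙 ⊕ K · γ) ^ᵣ (M ℕ.* m′)            ≡⟨ cong ((𝟙 ⊕ K · γ) ^ᵣ_) (ℕ.*-comm M m′) ⟩
            (𝟙 ⊕ K · γ) ^ᵣ (m′ ℕ.* M)            ≡⟨ cong ((𝟙 ⊕ K · γ) ^ᵣ_) m≡m′M ⟨
            (𝟙 ⊕ K · γ) ^ᵣ m                     ∎

  -- Closed forms of small binomials and small powers of α.

  2*tri : ∀ n → + 2 * + tri n ≡ + n * (+ n - 1ℤ)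
  2*tri zero    = refl
  2*tri (suc n) = trans (e₁ (+ n) (+ tri n)) (trans (cong (_+ + 2 * + n) (2*tri n)) (e₂ (+ n)))
    where
    e₁ : ∀ n t → + 2 * (t + n) ≡ + 2 * t + + 2 * n
    e₁ = solve-∀
    e₂ : ∀ n → n * (n - 1ℤ) + + 2 * n ≡ (1ℤ + n) * (1ℤ + n - 1ℤ)
    e₂ = solve-∀

  6*tet : ∀ n → + 6 * + tet n ≡ + n * (+ n - 1ℤ) * (+ n - + 2)
  6*tet zero    = refl
  6*tet (suc n) = begin
    + 6 * + tet (suc n)                                       ≡⟨ e₁ (+ tet n) (+ tri n) ⟩
    + 6 * + tet n + + 3 * (+ 2 * + tri n)                     ≡⟨ cong₂ (λ x y → x + + 3 * y) (6*tet n) (2*tri n) ⟩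
    + n * (+ n - 1ℤ) * (+ n - + 2) + + 3 * (+ n * (+ n - 1ℤ)) ≡⟨ e₂ (+ n) ⟩
    + suc n * (+ suc n - 1ℤ) * (+ suc n - + 2)                ∎
    where
    e₁ : ∀ t u → + 6 * (t + u) ≡ + 6 * t + + 3 * (+ 2 * u)
    e₁ = solve-∀
    e₂ : ∀ n → n * (n - 1ℤ) * (n - + 2) + + 3 * (n * (n - 1ℤ)) ≡ (1ℤ + n) * (1ℤ + n - 1ℤ) * (1ℤ + n - + 2)
    e₂ = solve-∀

  α-step : ∀ {d n u v u′ v′} → α d ^ᵣ n ≡ ⟨ u , v ⟩ → u + d * v ≡ u′ → u + v ≡ v′ →
    α d ^ᵣ suc n ≡ ⟨ u′ , v′ ⟩
  α-step {d} {u = u} {v} pow refl refl = trans (cong (α d ⊗_) pow) (cong₂ ⟨_,_⟩ (e₁ d u v) (e₂ u v))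
    where
    e₁ : ∀ d u v → 1ℤ * u + d * (1ℤ * v) ≡ u + d * v
    e₁ = solve-∀
    e₂ : ∀ u v → 1ℤ * v + 1ℤ * u ≡ u + v
    e₂ = solve-∀

  α¹ : ∀ d → α d ^ᵣ 1 ≡ ⟨ 1ℤ , 1ℤ ⟩
  α¹ d = α-step {n = 0} refl (e d) refl
    where
    e : ∀ d → 1ℤ + d * 0ℤ ≡ 1ℤ
    e = solve-∀

  α² : ∀ d → α d ^ᵣ 2 ≡ ⟨ 1ℤ + d , + 2 ⟩
  α² d = α-step {n = 1} (α¹ d) (e d) refl
    where
    e : ∀ d → 1ℤ + d * 1ℤ ≡ 1ℤ + d
    e = solve-∀

  α³ : ∀ d → α d ^ᵣ 3 ≡ ⟨ 1ℤ + + 3 * d , + 3 + d ⟩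
  α³ d = α-step {n = 2} (α² d) (e₁ d) (e₂ d)
    where
    e₁ : ∀ d → 1ℤ + d + d * + 2 ≡ 1ℤ + + 3 * d
    e₁ = solve-∀
    e₂ : ∀ d → 1ℤ + d + + 2 ≡ + 3 + d
    e₂ = solve-∀

  α⁴ : ∀ d → α d ^ᵣ 4 ≡ ⟨ 1ℤ + + 6 * d + d * d , + 4 + + 4 * d ⟩
  α⁴ d = α-step {n = 3} (α³ d) (e₁ d) (e₂ d)
    where
    e₁ : ∀ d → 1ℤ + + 3 * d + d * (+ 3 + d) ≡ 1ℤ + + 6 * d + d * d
    e₁ = solve-∀
    e₂ : ∀ d → 1ℤ + + 3 * d + (+ 3 + d) ≡ + 4 + + 4 * d
    e₂ = solve-∀

  im-α⁵ : ∀ d → im (α d ^ᵣ 5) ≡ + 5 + + 10 * d + d * d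
  im-α⁵ d = cong im (α-step {n = 4} (α⁴ d) refl (e d))
    where
    e : ∀ d → 1ℤ + + 6 * d + d * d + (+ 4 + + 4 * d) ≡ + 5 + + 10 * d + d * d
    e = solve-∀

  -- Even D: rigidity within a class of exponents modulo 4.

  module Even (e : ℕ) where

    private
      d = - (+ 2 * + e)

    -- The quotient (α⁴ - 1) / 4, integral since `6d + d²` is divisible by 4 for `d = −2e`.
    γ₄ : ℤ[√ d ]
    γ₄ = ⟨ + e * + e - + 3 * + e , 1ℤ - + 2 * + e ⟩

    α⁴≡1+4γ : α d ^ᵣ 4 ≡ 𝟙 ⊕ + 4 · γ₄
    α⁴≡1+4γ = trans (α⁴ d) (cong₂ ⟨_,_⟩ (e₁ (+ e)) (e₂ (+ e)))
      where
      e₁ : ∀ e → 1ℤ + + 6 * - (+ 2 * e) + - (+ 2 * e) * - (+ 2 * e) ≡ 1ℤ + + 4 * (e * e - + 3 * e)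
      e₁ = solve-∀
      e₂ : ∀ e → + 4 + + 4 * - (+ 2 * e) ≡ 0ℤ + + 4 * (1ℤ - + 2 * e)
      e₂ = solve-∀

    α-split : ∀ c m → α d ^ᵣ (c ℕ.+ 4 ℕ.* m) ≡ α d ^ᵣ c ⊗ (𝟙 ⊕ + 4 · γ₄) ^ᵣ m
    α-split c m = begin
      α d ^ᵣ (c ℕ.+ 4 ℕ.* m)               ≡⟨ ^-homo-* (α d) c (4 ℕ.* m) ⟩
      α d ^ᵣ c ⊗ α d ^ᵣ (4 ℕ.* m)          ≡⟨ cong (α d ^ᵣ c ⊗_) (^-assocʳ (α d) 4 m) ⟨
      α d ^ᵣ c ⊗ (α d ^ᵣ 4) ^ᵣ m           ≡⟨ cong (λ z → α d ^ᵣ c ⊗ z ^ᵣ m) α⁴≡1+4γ ⟩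
      α d ^ᵣ c ⊗ (𝟙 ⊕ + 4 · γ₄) ^ᵣ m       ∎

    im-mod-4 : ∀ c m → ∃[ x ] im (α d ^ᵣ (c ℕ.+ 4 ℕ.* m)) ≡ im (α d ^ᵣ c) + + 4 * x
    im-mod-4 c m = _ , trans (cong im (α-split c m)) (proj₂ (im-expand (α d ^ᵣ c) (+ 4) γ₄ m))

    rigid : ∀ c m {z} → α d ^ᵣ c ≡ z → im (z ⊗ γ₄) InvertibleMod + 2 →
      im (α d ^ᵣ (c ℕ.+ 4 ℕ.* m)) ≡ im z → m ≡ 0
    rigid c m refl inv eq = skolem (α d ^ᵣ c) 2 (s≤s (s≤s z≤n)) m (+ 4) γ₄
      -- For M = 2, `tri 2` is 1, so K = 4 just meets the condition M² ∣ `tri M * K`.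
      (divides (+ 2) refl) (divides 1ℤ refl) inv (trans (sym (cong im (α-split c m))) eq)

    -- `im (α ⊗ γ₄)` is `1 + e (e − 1) − 4e`, which is odd; `2*tri` supplies the half of
    -- `e (e − 1)`.
    rigid₁ : ∀ m → im (α d ^ᵣ (1 ℕ.+ 4 ℕ.* m)) ≡ 1ℤ → m ≡ 0
    rigid₁ m = rigid 1 m (α¹ d) (1ℤ , - (+ tri e - + 2 * + e) , trans (e₁ (+ e) (+ tri e))
      (trans (cong (λ x → 1ℤ + (+ e * (+ e - 1ℤ)) - x) (2*tri e)) (e₂ (+ e))))
      where
      e₁ : ∀ e t → 1ℤ * (1ℤ * (1ℤ - + 2 * e) + 1ℤ * (e * e - + 3 * e)) + - (t - + 2 * e) * + 2
         ≡ 1ℤ + (e * (e - 1ℤ)) - + 2 * t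
      e₁ = solve-∀
      e₂ : ∀ e → 1ℤ + (e * (e - 1ℤ)) - (e * (e - 1ℤ)) ≡ 1ℤ
      e₂ = solve-∀

    -- `im (α³ ⊗ γ₄)` is `1 + 21 e (e − 1) + 4e − 2e³`, again odd.
    rigid₃ : ∀ m → im (α d ^ᵣ (3 ℕ.+ 4 ℕ.* m)) ≡ + 3 + d → m ≡ 0
    rigid₃ m = rigid 3 m (α³ d) (1ℤ , - (+ 21 * + tri e + + 2 * + e - + e * + e * + e) , trans (e₁ (+ e) (+ tri e))
      (trans (cong (λ x → 1ℤ + + 21 * (+ e * (+ e - 1ℤ)) - + 21 * x) (2*tri e)) (e₂ (+ e))))
      where
      e₁ : ∀ e t → 1ℤ * ((1ℤ + + 3 * - (+ 2 * e)) * (1ℤ - + 2 * e) + (+ 3 + - (+ 2 * e)) * (e * e - + 3 * e))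
             + - (+ 21 * t + + 2 * e - e * e * e) * + 2
         ≡ 1ℤ + + 21 * (e * (e - 1ℤ)) - + 21 * (+ 2 * t)
      e₁ = solve-∀
      e₂ : ∀ e → 1ℤ + + 21 * (e * (e - 1ℤ)) - + 21 * (e * (e - 1ℤ)) ≡ 1ℤ
      e₂ = solve-∀

  ≡⇒∣- : ∀ {a b k x : ℤ} → a ≡ b + k * x → k ∣ a - b
  ≡⇒∣- {b = b} {k} {x} refl = divides x (e b k x)
    where
    e : ∀ b k x → b + k * x - b ≡ x * k
    e = solve-∀

  -- D ≡ 2 mod 4: rigidity modulo an odd divisor of D.

  im-α-linear : ∀ d n → ∃[ x ] im (α d ^ᵣ n) ≡ + n + d * x
  im-α-linear d n = let a , b , pow = α-expand d n in
    + tet n + d * b , trans (cong im pow) (e d (+ n) (+ tet n) b)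
    where
    e : ∀ d n t b → n + d * t + d * d * b ≡ n + d * (t + d * b)
    e = solve-∀

  -- Since `M ∣ d`, the coefficient of `α ^ᵣ suc n` is ≡ n + 1 modulo M, so the value 1 forces M ∣
  -- n. Then the power is `α ⊗ (𝟙 ⊕ M · γ) ^ᵣ m` with n = m M, and `skolem` applies with B = α and K
  -- = M.
  rigid-mod : ∀ {d} (γ : ℤ[√ d ]) M n → 1 ℕ.< M → + M ∣ d → + M ∣ + tri M →
    α d ^ᵣ M ≡ 𝟙 ⊕ + M · γ → im (α d ⊗ γ) InvertibleMod + M →
    im (α d ^ᵣ suc n) ≡ 1ℤ → n ≡ 0
  rigid-mod {d} γ M n 1<M (divides g d≡gM) M∣tri pow inv eq = finish (∣⇒∣ᵤ M∣n)
    where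
    instance
      M≢0 : ℕ.NonZero M
      M≢0 = ℕ.>-nonZero (ℕ.<-trans (s≤s z≤n) 1<M)
    M∣n : + M ∣ + n
    M∣n = let x , im≡ = im-α-linear d (suc n) in divides (- (g * x)) (begin
      + n                                ≡⟨ e₁ (+ n) d x ⟩
      + suc n + d * x - 1ℤ - d * x       ≡⟨ cong (λ y → y - 1ℤ - d * x) (trans (sym im≡) eq) ⟩
      1ℤ - 1ℤ - d * x                    ≡⟨ cong (λ y → 1ℤ - 1ℤ - y * x) d≡gM ⟩
      1ℤ - 1ℤ - g * + M * x              ≡⟨ e₂ g (+ M) x ⟩
      - (g * x) * + M                    ∎)
      where
      e₁ : ∀ n d x → n ≡ 1ℤ + n + d * x - 1ℤ - d * x
      e₁ = solve-∀
      e₂ : ∀ g M x → 1ℤ - 1ℤ - g * M * x ≡ - (g * x) * M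
      e₂ = solve-∀
    finish : M ℕ.∣ n → n ≡ 0
    finish (ℕ.divides m n≡mM) = trans n≡mM (cong (ℕ._* M) (skolem (α d) M 1<M m (+ M) γ ∣-refl M²∣ inv
      (trans (cong (λ z → im (α d ⊗ z)) same-pow) eq)))
      where
      M²∣ : + M * + M ∣ + tri M * + M
      M²∣ = let divides q tri≡ = M∣tri in
        divides q (trans (cong (_* + M) tri≡) (e q (+ M)))
        where
        e : ∀ q M → q * M * M ≡ q * (M * M)
        e = solve-∀
      same-pow : (𝟙 ⊕ + M · γ) ^ᵣ m ≡ α d ^ᵣ n
      same-pow = begin
        (𝟙 ⊕ + M · γ) ^ᵣ m  ≡⟨ cong (_^ᵣ m) pow ⟨
        (α d ^ᵣ M) ^ᵣ m     ≡⟨ ^-assocʳ (α d) M m ⟩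
        α d ^ᵣ (M ℕ.* m)    ≡⟨ cong (α d ^ᵣ_) (ℕ.*-comm M m) ⟩
        α d ^ᵣ (m ℕ.* M)    ≡⟨ cong (α d ^ᵣ_) n≡mM ⟨
        α d ^ᵣ n            ∎

  -- The conditions on `tri M` and `tet M` amount to gcd(M, 6) = 1. They give αᴹ ≡ 1 + M√d modulo
  -- M², so γ ≡ √d and `im (α ⊗ γ)` ≡ 1 modulo M.
  rigid-coprime-6 : ∀ {d} M n → 1 ℕ.< M → + M ∣ d → + M ∣ + tri M → + M ∣ + tet M →
    im (α d ^ᵣ suc n) ≡ 1ℤ → n ≡ 0
  rigid-coprime-6 {d} M n 1<M M∣d@(divides g d≡gM) M∣tri@(divides s tri≡sM) (divides t tet≡tM) =
    rigid-mod ⟨ x , 1ℤ + + M * y ⟩ M n 1<M M∣d M∣tri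
      (trans pow (cong₂ ⟨_,_⟩ (re≡ d (+ tri M) d≡gM tri≡sM) (im≡ d (+ tet M) d≡gM tet≡tM)))
      (1ℤ , - (y + g * s + g * g * a) , e₃ (+ M) g s a y)
    where
    a = proj₁ (α-expand d M)
    b = proj₁ (proj₂ (α-expand d M))
    pow = proj₂ (proj₂ (α-expand d M))
    x = + M * (g * s + g * g * a)
    y = g * t + g * g * b
    re≡ : ∀ d T → d ≡ g * + M → T ≡ s * + M → 1ℤ + d * T + d * d * a ≡ 1ℤ + + M * x
    re≡ _ _ refl refl = e₁ g (+ M) s a
      where
      e₁ : ∀ g M s a → 1ℤ + g * M * (s * M) + g * M * (g * M) * a ≡ 1ℤ + M * (M * (g * s + g * g * a))
      e₁ = solve-∀
    im≡ : ∀ d T → d ≡ g * + M → T ≡ t * + M → + M + d * T + d * d * b ≡ 0ℤ + + M * (1ℤ + + M * y)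
    im≡ _ _ refl refl = e₂ g (+ M) t b
      where
      e₂ : ∀ g M t b → M + g * M * (t * M) + g * M * (g * M) * b ≡ 0ℤ + M * (1ℤ + M * (g * t + g * g * b))
      e₂ = solve-∀
    e₃ : ∀ M g s a y → 1ℤ * (1ℤ * (1ℤ + M * y) + 1ℤ * (M * (g * s + g * g * a)))
           + - (y + g * s + g * g * a) * M ≡ 1ℤ
    e₃ = solve-∀

  rigid-1+6k : ∀ {d} M n k → + M ≡ 1ℤ + + 6 * k → 1 ℕ.< M → + M ∣ d →
    im (α d ^ᵣ suc n) ≡ 1ℤ → n ≡ 0
  rigid-1+6k M n k M≡ 1<M M∣d = rigid-coprime-6 M n 1<M M∣d
    -- The cofactors of M in `tri M` and `tet M` are (M - 1) / 2 and (M - 1)(M - 2) / 6.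
    (divides (+ 3 * k) (*-cancelˡ-≡ (+ 2) _ _ (trans (2*tri M) (e₁ (+ M) M≡))))
    (divides (k * (+ 6 * k - 1ℤ)) (*-cancelˡ-≡ (+ 6) _ _ (trans (6*tet M) (e₂ (+ M) M≡))))
    where
    e₁ : ∀ M → M ≡ 1ℤ + + 6 * k → M * (M - 1ℤ) ≡ + 2 * (+ 3 * k * M)
    e₁ _ refl = e k
      where
      e : ∀ k → (1ℤ + + 6 * k) * (1ℤ + + 6 * k - 1ℤ) ≡ + 2 * (+ 3 * k * (1ℤ + + 6 * k))
      e = solve-∀
    e₂ : ∀ M → M ≡ 1ℤ + + 6 * k → M * (M - 1ℤ) * (M - + 2) ≡ + 6 * (k * (+ 6 * k - 1ℤ) * M)
    e₂ _ refl = e k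
      where
      e : ∀ k → (1ℤ + + 6 * k) * (1ℤ + + 6 * k - 1ℤ) * (1ℤ + + 6 * k - + 2)
              ≡ + 6 * (k * (+ 6 * k - 1ℤ) * (1ℤ + + 6 * k))
      e = solve-∀

  rigid-5+6k : ∀ {d} M n k → + M ≡ + 5 + + 6 * k → 1 ℕ.< M → + M ∣ d →
    im (α d ^ᵣ suc n) ≡ 1ℤ → n ≡ 0
  rigid-5+6k M n k M≡ 1<M M∣d = rigid-coprime-6 M n 1<M M∣d
    (divides (+ 2 + + 3 * k) (*-cancelˡ-≡ (+ 2) _ _ (trans (2*tri M) (e₁ (+ M) M≡))))
    (divides ((+ 2 + + 3 * k) * (1ℤ + + 2 * k)) (*-cancelˡ-≡ (+ 6) _ _ (trans (6*tet M) (e₂ (+ M) M≡))))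
    where
    e₁ : ∀ M → M ≡ + 5 + + 6 * k → M * (M - 1ℤ) ≡ + 2 * ((+ 2 + + 3 * k) * M)
    e₁ _ refl = e k
      where
      e : ∀ k → (+ 5 + + 6 * k) * (+ 5 + + 6 * k - 1ℤ) ≡ + 2 * ((+ 2 + + 3 * k) * (+ 5 + + 6 * k))
      e = solve-∀
    e₂ : ∀ M → M ≡ + 5 + + 6 * k →
      M * (M - 1ℤ) * (M - + 2) ≡ + 6 * ((+ 2 + + 3 * k) * (1ℤ + + 2 * k) * M)
    e₂ _ refl = e k
      where
      e : ∀ k → (+ 5 + + 6 * k) * (+ 5 + + 6 * k - 1ℤ) * (+ 5 + + 6 * k - + 2)
              ≡ + 6 * ((+ 2 + + 3 * k) * (1ℤ + + 2 * k) * (+ 5 + + 6 * k))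
      e = solve-∀

  -- `tet 3` = 1 is not a multiple of 3, so α³ is used directly. The invertibility condition means g
  -- ≢ 1 modulo 3.
  rigid-3 : ∀ {d} g n → d ≡ - (+ 3 * g) → (1ℤ - + 4 * g) InvertibleMod + 3 →
    im (α d ^ᵣ suc n) ≡ 1ℤ → n ≡ 0
  rigid-3 g n refl inv =
    rigid-mod ⟨ - (+ 3 * g) , 1ℤ - g ⟩ 3 n (s≤s (s≤s z≤n)) (divides (- g) (e₁ g)) (divides 1ℤ refl)
      (trans (α³ (- (+ 3 * g))) (cong₂ ⟨_,_⟩ (e₂ g) (e₃ g)))
      (subst (_InvertibleMod + 3) (e₄ g) inv)
    where
    e₁ : ∀ g → - (+ 3 * g) ≡ - g * + 3
    e₁ = solve-∀
    e₂ : ∀ g → 1ℤ + + 3 * - (+ 3 * g) ≡ 1ℤ + + 3 * - (+ 3 * g)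
    e₂ g = refl
    e₃ : ∀ g → + 3 + - (+ 3 * g) ≡ 0ℤ + + 3 * (1ℤ - g)
    e₃ = solve-∀
    e₄ : ∀ g → 1ℤ - + 4 * g ≡ 1ℤ * (1ℤ - g) + 1ℤ * - (+ 3 * g)
    e₄ = solve-∀

  -- D = 2 (1 + 2q). If 3 does not divide 1 + 2q, that is q ≢ 1 modulo 3, then M = 1 + 2q is coprime
  -- to 6, and `0 < q` ensures M > 1.
  rigid-2+4q : ∀ q n → 0 ℕ.< q → im (α (- (+ 2 + + 4 * + q)) ^ᵣ suc n) ≡ 1ℤ → n ≡ 0
  rigid-2+4q q n 0<q im≡1 with q divMod 3
  ... | result zero    zero             refl = ⊥-elim (ℕ.<-irrefl refl 0<q)
  ... | result a@(suc _) zero           refl =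
    rigid-1+6k (1 ℕ.+ 6 ℕ.* a) n (+ a) (cong (λ x → 1ℤ + x) (pos-* 6 a)) (s≤s (s≤s z≤n))
      (divides (- + 2) (e (+ a) (pos-* a 3) (pos-* 6 a))) im≡1
    where
    e : ∀ {x y} a → x ≡ a * + 3 → y ≡ + 6 * a → - (+ 2 + + 4 * x) ≡ - + 2 * (1ℤ + y)
    e a refl refl = e′ a
      where
      e′ : ∀ a → - (+ 2 + + 4 * (a * + 3)) ≡ - + 2 * (1ℤ + + 6 * a)
      e′ = solve-∀
  ... | result a (suc (suc zero)) refl =
    rigid-5+6k (5 ℕ.+ 6 ℕ.* a) n (+ a) (cong (λ x → + 5 + x) (pos-* 6 a)) (s≤s (s≤s z≤n))
      (divides (- + 2) (e (+ a) (pos-* a 3) (pos-* 6 a))) im≡1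
    where
    e : ∀ {x y} a → x ≡ a * + 3 → y ≡ + 6 * a → - (+ 2 + + 4 * (+ 2 + x)) ≡ - + 2 * (+ 5 + y)
    e a refl refl = e′ a
      where
      e′ : ∀ a → - (+ 2 + + 4 * (+ 2 + a * + 3)) ≡ - + 2 * (+ 5 + + 6 * a)
      e′ = solve-∀
  -- Now D = 6 (1 + 2a). M = 3 works when D / 3 = 2 + 4a is not ≡ 1 modulo 3. The exception is a = 2
  -- + 3b, where 1 + 2a = 5 + 6b is coprime to 6 and serves as M.
  ... | result a (suc zero) refl with a divMod 3
  ... | result b zero refl =
    rigid-3 (+ 2 + + 12 * + b) n (e₁ (+ b) (pos-* (b ℕ.* 3) 3) (pos-* b 3))
      (- 1ℤ , - (+ 2 + + 16 * + b) , e₂ (+ b)) im≡1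
    where
    e₁ : ∀ {x y} b → x ≡ y * + 3 → y ≡ b * + 3 → - (+ 2 + + 4 * (1ℤ + x)) ≡ - (+ 3 * (+ 2 + + 12 * b))
    e₁ b refl refl = e b
      where
      e : ∀ b → - (+ 2 + + 4 * (1ℤ + b * + 3 * + 3)) ≡ - (+ 3 * (+ 2 + + 12 * b))
      e = solve-∀
    e₂ : ∀ b → - 1ℤ * (1ℤ - + 4 * (+ 2 + + 12 * b)) + - (+ 2 + + 16 * b) * + 3 ≡ 1ℤ
    e₂ = solve-∀
  ... | result b (suc zero) refl =
    rigid-3 (+ 6 + + 12 * + b) n (e₁ (+ b) (pos-* (1 ℕ.+ b ℕ.* 3) 3) (pos-* b 3))
      (1ℤ , + 8 + + 16 * + b , e₂ (+ b)) im≡1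
    where
    e₁ : ∀ {x y} b → x ≡ (1ℤ + y) * + 3 → y ≡ b * + 3 → - (+ 2 + + 4 * (1ℤ + x)) ≡ - (+ 3 * (+ 6 + + 12 * b))
    e₁ b refl refl = e b
      where
      e : ∀ b → - (+ 2 + + 4 * (1ℤ + (1ℤ + b * + 3) * + 3)) ≡ - (+ 3 * (+ 6 + + 12 * b))
      e = solve-∀
    e₂ : ∀ b → 1ℤ * (1ℤ - + 4 * (+ 6 + + 12 * b)) + (+ 8 + + 16 * b) * + 3 ≡ 1ℤ
    e₂ = solve-∀
  ... | result b (suc (suc zero)) refl =
    rigid-5+6k (5 ℕ.+ 6 ℕ.* b) n (+ b) (cong (λ x → + 5 + x) (pos-* 6 b)) (s≤s (s≤s z≤n))
      (divides (- + 6) (e (+ b) (pos-* (2 ℕ.+ b ℕ.* 3) 3) (pos-* b 3) (pos-* 6 b))) im≡1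
    where
    e : ∀ {x y z} b → x ≡ (+ 2 + y) * + 3 → y ≡ b * + 3 → z ≡ + 6 * b →
      - (+ 2 + + 4 * (1ℤ + x)) ≡ - + 6 * (+ 5 + z)
    e b refl refl refl = e′ b
      where
      e′ : ∀ b → - (+ 2 + + 4 * (1ℤ + (+ 2 + b * + 3) * + 3)) ≡ - + 6 * (+ 5 + + 6 * b)
      e′ = solve-∀

  -- Coefficient -1: constraints from D and Q = 1 + D.

  -- α has trace 2 and norm Q, so α² = 2α - Q: modulo Q each further factor α only doubles, and
  -- `α ^ᵣ suc n` ≡ 2ⁿ α.
  α-mod : ∀ {d} Q → d ≡ 1ℤ - Q → ∀ n → ∃[ a ] ∃[ b ]
    α d ^ᵣ suc n ≡ ⟨ + (2 ^ n) + Q * a , + (2 ^ n) + Q * b ⟩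
  α-mod {d} Q d≡ zero = 0ℤ , 0ℤ , trans (α¹ d) (cong₂ ⟨_,_⟩ (e Q) (e Q))
    where
    e : ∀ Q → 1ℤ ≡ 1ℤ + Q * 0ℤ
    e = solve-∀
  α-mod {d} Q refl (suc n) =
    let a , b , pow = α-mod Q refl n in
    a + b - + (2 ^ n) - Q * b , a + b ,
    α-step {n = suc n} pow
      (trans (e₁ Q a b (+ (2 ^ n))) (cong (λ x → x + Q * (a + b - + (2 ^ n) - Q * b)) (sym (pos-* 2 (2 ^ n)))))
      (trans (e₂ Q a b (+ (2 ^ n))) (cong (λ x → x + Q * (a + b)) (sym (pos-* 2 (2 ^ n)))))
    where
    e₁ : ∀ Q a b t → t + Q * a + (1ℤ - Q) * (t + Q * b) ≡ + 2 * t + Q * (a + b - t - Q * b)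
    e₁ = solve-∀
    e₂ : ∀ Q a b t → t + Q * a + (t + Q * b) ≡ + 2 * t + Q * (a + b)
    e₂ = solve-∀

  im≡-1⇒Q∣2^n+1 : ∀ {d} Q → d ≡ 1ℤ - + Q → ∀ n → im (α d ^ᵣ suc n) ≡ -1ℤ → Q ℕ.∣ 2 ^ n ℕ.+ 1
  im≡-1⇒Q∣2^n+1 Q d≡ n eq =
    let _ , b , pow = α-mod (+ Q) d≡ n in
    ∣⇒∣ᵤ {+ Q} {+ (2 ^ n) + 1ℤ} (divides (- b) (e (+ (2 ^ n)) (+ Q) b (trans (sym (cong im pow)) eq)))
    where
    e : ∀ t Q b → t + Q * b ≡ -1ℤ → t + 1ℤ ≡ - b * Q
    e t Q b eq = begin
      t + 1ℤ                    ≡⟨ e₁ t Q b ⟩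
      (t + Q * b) + 1ℤ - Q * b  ≡⟨ cong (λ x → x + 1ℤ - Q * b) eq ⟩
      -1ℤ + 1ℤ - Q * b          ≡⟨ e₂ Q b ⟩
      - b * Q                   ∎
      where
      e₁ : ∀ t Q b → t + 1ℤ ≡ (t + Q * b) + 1ℤ - Q * b
      e₁ = solve-∀
      e₂ : ∀ Q b → -1ℤ + 1ℤ - Q * b ≡ - b * Q
      e₂ = solve-∀

  im≡-1⇒D∣1+r : ∀ D r → im (α (- + D) ^ᵣ r) ≡ -1ℤ → D ℕ.∣ suc r
  im≡-1⇒D∣1+r D r eq =
    let x , im≡ = im-α-linear (- + D) r in
    ∣⇒∣ᵤ {+ D} {+ suc r} (divides x (e (+ r) (+ D) x (trans (sym im≡) eq)))
    where
    e : ∀ r D x → r + - D * x ≡ -1ℤ → 1ℤ + r ≡ x * D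
    e r D x eq = begin
      1ℤ + r                       ≡⟨ e₁ r D x ⟩
      1ℤ + (r + - D * x) + x * D   ≡⟨ cong (λ y → 1ℤ + y + x * D) eq ⟩
      1ℤ + -1ℤ + x * D             ≡⟨ e₂ x D ⟩
      x * D                        ∎
      where
      e₁ : ∀ r D x → 1ℤ + r ≡ 1ℤ + (r + - D * x) + x * D
      e₁ = solve-∀
      e₂ : ∀ x D → 1ℤ + -1ℤ + x * D ≡ x * D
      e₂ = solve-∀

  1+km-pow : ∀ k m n → ∃[ x ] (1 ℕ.+ k ℕ.* m) ^ n ≡ 1 ℕ.+ x ℕ.* m
  1+km-pow k m zero = 0 , refl
  1+km-pow k m (suc n) = let x , eq = 1+km-pow k m n in
    x ℕ.+ k ℕ.+ k ℕ.* m ℕ.* x , trans (cong ((1 ℕ.+ k ℕ.* m) ℕ.*_) eq) (e k m x)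
    where
    e : ∀ k m x → (1 ℕ.+ k ℕ.* m) ℕ.* (1 ℕ.+ x ℕ.* m) ≡ 1 ℕ.+ (x ℕ.+ k ℕ.+ k ℕ.* m ℕ.* x) ℕ.* m
    e = ℕ.solve-∀

  -- The prime is `suc p`, so the exponent `p` is the prime minus one. Fermat makes it divide 2 (2ᵖ
  -- - 1), and Euclid's lemma removes the 2.
  2^[p-1]≡1 : ∀ {p} → Prime (suc p) → ¬ suc p ℕ.∣ 2 → ∃[ c ] 2 ^ p ≡ 1 ℕ.+ c ℕ.* suc p
  2^[p-1]≡1 {p} pr p∤2 with fermat-2 pr
  ... | c , 2^p≡ with euclidsLemma 2 (ℕ.pred (2 ^ p)) pr (ℕ.divides c 2u≡cp)
    where
    2u≡cp : 2 ℕ.* ℕ.pred (2 ^ p) ≡ c ℕ.* suc p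
    2u≡cp = ℕ.+-cancelˡ-≡ 2 _ _ (trans (e (ℕ.pred (2 ^ p))) (trans (cong (2 ℕ.*_) (ℕ.suc-pred (2 ^ p) {{ℕ.m^n≢0 2 p}})) 2^p≡))
      where
      e : ∀ u → 2 ℕ.+ 2 ℕ.* u ≡ 2 ℕ.* suc u
      e = ℕ.solve-∀
  ... | inj₁ p∣2 = ⊥-elim (p∤2 p∣2)
  ... | inj₂ (ℕ.divides b u≡bp) = b , trans (sym (ℕ.suc-pred (2 ^ p) {{ℕ.m^n≢0 2 p}})) (cong suc u≡bp)

  -- Fermat gives 2³⁺ⁿ ≡ 1 modulo `suc p`, hence 0 ≡ 4 (2¹⁺ⁿ + 1) = 2³⁺ⁿ + 4 ≡ 5. The prime 2 is
  -- excluded because 2¹⁺ⁿ + 1 is odd.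
  p∣5 : ∀ {p n} → Prime (suc p) → p ℕ.∣ 3 ℕ.+ n → suc p ℕ.∣ 2 ^ suc n ℕ.+ 1 → suc p ≡ 5
  p∣5 {p} {n} pr (ℕ.divides l 3+n≡lp) p∣2^+1
    with 2^[p-1]≡1 pr (λ p∣2 → ¬∣1 (ℕ.∣m+n∣m⇒∣n p∣2^+1 (ℕ.∣m⇒∣m*n (2 ^ n) p∣2)))
    where
    ¬∣1 : ¬ suc p ℕ.∣ 1
    ¬∣1 p∣1 = ¬prime[1] (subst Prime (ℕ.∣1⇒≡1 p∣1) pr)
  ... | c , 2^p≡ with 1+km-pow c (suc p) l
  ... | x , pow with prime⇒irreducible (from-yes (prime? 5)) (ℕ.∣m+n∣m⇒∣n
         (subst (suc p ℕ.∣_) (trans (e (2 ^ n)) (trans (cong (4 ℕ.+_) 2^≡) (ℕ.+-comm 5 (x ℕ.* suc p))))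
           (ℕ.∣n⇒∣m*n 4 p∣2^+1)) (ℕ.n∣m*n x))
    where
    e : ∀ t → 4 ℕ.* (2 ℕ.* t ℕ.+ 1) ≡ 4 ℕ.+ 2 ℕ.* (2 ℕ.* (2 ℕ.* t))
    e = ℕ.solve-∀
    2^≡ : 2 ^ (3 ℕ.+ n) ≡ 1 ℕ.+ x ℕ.* suc p
    2^≡ = begin
      2 ^ (3 ℕ.+ n)              ≡⟨ cong (2 ^_) (trans 3+n≡lp (ℕ.*-comm l p)) ⟩
      2 ^ (p ℕ.* l)              ≡⟨ ℕ.^-*-assoc 2 p l ⟨
      (2 ^ p) ^ l                ≡⟨ cong (_^ l) 2^p≡ ⟩
      (1 ℕ.+ c ℕ.* suc p) ^ l    ≡⟨ pow ⟩
      1 ℕ.+ x ℕ.* suc p          ∎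
  ... | inj₁ p≡1 = ⊥-elim (¬prime[1] (subst Prime p≡1 pr))
  ... | inj₂ p≡5 = p≡5

  -- Q = 5ᵏ with k ≥ 2.

  -- 4¹⁰ = 1 + 41943 · 25, so ten residues of n suffice; among them only n = 5 satisfies the
  -- hypothesis.
  25∣4^n+1⇒5∣n : ∀ n → 25 ℕ.∣ 4 ^ n ℕ.+ 1 → 5 ℕ.∣ n
  25∣4^n+1⇒5∣n 0 h = ⊥-elim (from-no (25 ℕ.∣? 2) h)
  25∣4^n+1⇒5∣n 1 h = ⊥-elim (from-no (25 ℕ.∣? 5) h)
  25∣4^n+1⇒5∣n 2 h = ⊥-elim (from-no (25 ℕ.∣? 17) h)
  25∣4^n+1⇒5∣n 3 h = ⊥-elim (from-no (25 ℕ.∣? 65) h)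
  25∣4^n+1⇒5∣n 4 h = ⊥-elim (from-no (25 ℕ.∣? 257) h)
  25∣4^n+1⇒5∣n 5 h = ℕ.divides 1 refl
  25∣4^n+1⇒5∣n 6 h = ⊥-elim (from-no (25 ℕ.∣? 4097) h)
  25∣4^n+1⇒5∣n 7 h = ⊥-elim (from-no (25 ℕ.∣? 16385) h)
  25∣4^n+1⇒5∣n 8 h = ⊥-elim (from-no (25 ℕ.∣? 65537) h)
  25∣4^n+1⇒5∣n 9 h = ⊥-elim (from-no (25 ℕ.∣? 262145) h)
  25∣4^n+1⇒5∣n (suc (suc (suc (suc (suc (suc (suc (suc (suc (suc n)))))))))) h =
    ℕ.∣m∣n⇒∣m+n (ℕ.divides 2 refl) (25∣4^n+1⇒5∣n n (ℕ.∣m+n∣m⇒∣n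
      (subst (25 ℕ.∣_) (e (4 ^ n)) (subst (λ t → 25 ℕ.∣ t ℕ.+ 1) (ℕ.^-distribˡ-+-* 4 10 n) h)) (ℕ.n∣m*n (41943 ℕ.* 4 ^ n))))
    where
    e : ∀ t → 1048576 ℕ.* t ℕ.+ 1 ≡ 41943 ℕ.* t ℕ.* 25 ℕ.+ (t ℕ.+ 1)
    e = ℕ.solve-∀

  -- Modulo `im z`, z is an ordinary integer, and so are its powers. With z = α⁵ this is the
  -- divisibility U₅ ∣ U₅ⱼ.
  im∣im-pow : ∀ {d} (z : ℤ[√ d ]) n → im z ∣ im (z ^ᵣ n)
  im∣im-pow z zero = divides 0ℤ refl
  im∣im-pow z@(⟨ x , y ⟩) (suc n) =
    let divides q im≡ = im∣im-pow z n ; u = ℤ[√_].re (z ^ᵣ n) in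
    divides (x * q + u) (trans (cong (λ v → x * v + y * u) im≡) (e x y q u))
    where
    e : ∀ x y q u → x * (q * y) + y * u ≡ (x * q + u) * y
    e = solve-∀

  -- With αⁿ = x + y√d, im(α²ⁿ⁺¹) = x² + 2xy + d y².
  im-αⁿ∣x²+1 : ∀ d n → im (α d ^ᵣ suc (n ℕ.* 2)) ≡ -1ℤ →
    ∃[ x ] im (α d ^ᵣ n) ∣ + x * + x + 1ℤ
  im-αⁿ∣x²+1 d n eq = ∣ x ∣ , subst (λ s → y ∣ s + 1ℤ) (square x) (divides (- (d * y) - + 2 * x) (begin
      x * x + 1ℤ                                          ≡⟨ e₁ d x y ⟩
      S + 1ℤ + (- (d * y) - + 2 * x) * y                  ≡⟨ cong (λ s → s + 1ℤ + (- (d * y) - + 2 * x) * y) S≡-1 ⟩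
      -1ℤ + 1ℤ + (- (d * y) - + 2 * x) * y                ≡⟨ e₂ ((- (d * y) - + 2 * x) * y) ⟩
      (- (d * y) - + 2 * x) * y                           ∎))
    where
    z = α d ^ᵣ n
    x = ℤ[√_].re z
    y = im z
    S = x * x + d * (y * y) + (x * y + y * x)
    square : ∀ i → i * i ≡ + ∣ i ∣ * + ∣ i ∣
    square (+ _)    = refl
    square -[1+ _ ] = refl
    pow : α d ^ᵣ (n ℕ.* 2) ≡ z ⊗ z
    pow = trans (sym (^-assocʳ (α d) n 2)) (cong (z ⊗_) (trans (⊗-comm z 𝟙) (⊗-identityˡ z)))
    S≡-1 : S ≡ -1ℤ
    S≡-1 = trans (sym (cong im (α-step {n = n ℕ.* 2} pow refl refl))) eq
    e₁ : ∀ d x y → x * x + 1ℤ ≡ x * x + d * (y * y) + (x * y + y * x) + 1ℤ + (- (d * y) - + 2 * x) * y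
    e₁ = solve-∀
    e₂ : ∀ u → -1ℤ + 1ℤ + u ≡ u
    e₂ = solve-∀

  5^[1+j] : ∀ j → ∃[ g ] 5 ^ suc j ≡ 5 ℕ.+ 4 ℕ.* g
  5^[1+j] zero = 0 , refl
  5^[1+j] (suc j) = let g , eq = 5^[1+j] j in 5 ℕ.+ 5 ℕ.* g , trans (cong (5 ℕ.*_) eq) (e g)
    where
    e : ∀ g → 5 ℕ.* (5 ℕ.+ 4 ℕ.* g) ≡ 5 ℕ.+ 4 ℕ.* (5 ℕ.+ 5 ℕ.* g)
    e = ℕ.solve-∀

  -- In terms of Q = 1 − d, im(α⁵) = Q² − 12Q + 16.
  --   Q = R² :   (R² − 2R − 4)(R² + 2R − 4)
  --   Q = 5s² :  (5(s − 1)² − 1)(5(s + 1)² − 1)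
  im-α⁵-factor : ∀ {d} k → d ≡ 1ℤ - + (5 ^ (2 ℕ.+ k)) →
    ∃[ t ] + (3 ℕ.+ 4 ℕ.* t) ∣ im (α d ^ᵣ 5)
  im-α⁵-factor {d} k refl = by-parity (k divMod 2)
    where
    square : ∀ j → 5 ^ (2 ℕ.+ j ℕ.* 2) ≡ 5 ^ suc j ℕ.* 5 ^ suc j
    square j = trans (sym (ℕ.^-*-assoc 5 (suc j) 2)) (cong (5 ^ suc j ℕ.*_) (ℕ.*-identityʳ (5 ^ suc j)))
    poly : ℤ → ℤ
    poly Q = + 5 + + 10 * (1ℤ - Q) + (1ℤ - Q) * (1ℤ - Q)
    -- For R = 5 + 4g, the divisor R² - 2R - 4 is 11 + 32g + 16g² = 3 + 4 (2 + T).
    even-case : ∀ g T f Q → T ≡ + 8 * g + + 4 * (g * g) → f ≡ + 3 + + 4 * (+ 2 + T) →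
      Q ≡ (+ 5 + + 4 * g) * (+ 5 + + 4 * g) → f ∣ poly Q
    even-case g _ _ _ refl refl refl = divides
      ((+ 5 + + 4 * g) * (+ 5 + + 4 * g) + + 2 * (+ 5 + + 4 * g) - + 4) (e g)
      where
      e : ∀ g → + 5 + + 10 * (1ℤ - (+ 5 + + 4 * g) * (+ 5 + + 4 * g))
            + (1ℤ - (+ 5 + + 4 * g) * (+ 5 + + 4 * g)) * (1ℤ - (+ 5 + + 4 * g) * (+ 5 + + 4 * g))
          ≡ ((+ 5 + + 4 * g) * (+ 5 + + 4 * g) + + 2 * (+ 5 + + 4 * g) - + 4)
            * (+ 3 + + 4 * (+ 2 + (+ 8 * g + + 4 * (g * g))))
      e = solve-∀
    -- For s = 5 + 4g, s - 1 is a multiple of 4, so the divisor 5 (s - 1)² - 1 is ≡ 3 modulo 4; it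
    -- equals 3 + 4 (19 + T).
    odd-case : ∀ g T f Q → T ≡ + 40 * g + + 20 * (g * g) → f ≡ + 3 + + 4 * (+ 19 + T) →
      Q ≡ + 5 * ((+ 5 + + 4 * g) * (+ 5 + + 4 * g)) → f ∣ poly Q
    odd-case g _ _ _ refl refl refl = divides (+ 5 * ((+ 6 + + 4 * g) * (+ 6 + + 4 * g)) - 1ℤ) (e g)
      where
      e : ∀ g → + 5 + + 10 * (1ℤ - + 5 * ((+ 5 + + 4 * g) * (+ 5 + + 4 * g)))
            + (1ℤ - + 5 * ((+ 5 + + 4 * g) * (+ 5 + + 4 * g))) * (1ℤ - + 5 * ((+ 5 + + 4 * g) * (+ 5 + + 4 * g)))
          ≡ (+ 5 * ((+ 6 + + 4 * g) * (+ 6 + + 4 * g)) - 1ℤ)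
            * (+ 3 + + 4 * (+ 19 + (+ 40 * g + + 20 * (g * g))))
      e = solve-∀
    pos-T : ∀ a b g → + (a ℕ.* g ℕ.+ b ℕ.* (g ℕ.* g)) ≡ + a * + g + + b * (+ g * + g)
    pos-T a b g = cong₂ _+_ (pos-* a g) (trans (pos-* b (g ℕ.* g)) (cong (+ b *_) (pos-* g g)))
    pos-R : ∀ {R g} → R ≡ 5 ℕ.+ 4 ℕ.* g → + (R ℕ.* R) ≡ (+ 5 + + 4 * + g) * (+ 5 + + 4 * + g)
    pos-R {R} {g} refl = trans (pos-* R R) (cong (λ x → (+ 5 + x) * (+ 5 + x)) (pos-* 4 g))
    pos-f : ∀ x T → + (3 ℕ.+ 4 ℕ.* (x ℕ.+ T)) ≡ + 3 + + 4 * (+ x + + T)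
    pos-f x T = cong (λ y → + 3 + y) (pos-* 4 (x ℕ.+ T))
    by-parity : DivMod k 2 → ∃[ t ] + (3 ℕ.+ 4 ℕ.* t) ∣ im (α d ^ᵣ 5)
    by-parity (result j zero k≡) = let g , R≡ = 5^[1+j] j ; T = 8 ℕ.* g ℕ.+ 4 ℕ.* (g ℕ.* g) in
      2 ℕ.+ T , subst (+ (3 ℕ.+ 4 ℕ.* (2 ℕ.+ T)) ∣_) (sym (im-α⁵ d))
        (even-case (+ g) (+ T) (+ (3 ℕ.+ 4 ℕ.* (2 ℕ.+ T))) (+ (5 ^ (2 ℕ.+ k))) (pos-T 8 4 g) (pos-f 2 T)
          (trans (cong +_ (trans (cong (λ i → 5 ^ (2 ℕ.+ i)) k≡) (square j))) (pos-R {g = g} R≡)))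
    by-parity (result j (suc zero) k≡) = let g , R≡ = 5^[1+j] j ; T = 40 ℕ.* g ℕ.+ 20 ℕ.* (g ℕ.* g) in
      19 ℕ.+ T , subst (+ (3 ℕ.+ 4 ℕ.* (19 ℕ.+ T)) ∣_) (sym (im-α⁵ d))
        (odd-case (+ g) (+ T) (+ (3 ℕ.+ 4 ℕ.* (19 ℕ.+ T))) (+ (5 ^ (2 ℕ.+ k))) (pos-T 40 20 g) (pos-f 19 T)
          (trans (cong +_ (trans (cong (λ i → 5 ^ (2 ℕ.+ i)) k≡) (cong (5 ℕ.*_) (square j))))
            (trans (pos-* 5 (5 ^ suc j ℕ.* 5 ^ suc j)) (cong (+ 5 *_) (pos-R {g = g} R≡)))))

  im≢-1-5^[2+k] : ∀ {d} k n → d ≡ 1ℤ - + (5 ^ (2 ℕ.+ k)) → ¬ im (α d ^ᵣ suc (n ℕ.* 2)) ≡ -1ℤ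
  im≢-1-5^[2+k] {d} k n d≡ eq = contradiction (25∣4^n+1⇒5∣n n 25∣4^n+1)
    where
    25∣4^n+1 : 25 ℕ.∣ 4 ^ n ℕ.+ 1
    25∣4^n+1 = ℕ.∣-trans (ℕ.divides (5 ^ k) (trans (ℕ.^-distribˡ-+-* 5 2 k) (ℕ.*-comm 25 (5 ^ k))))
      (subst (λ x → 5 ^ (2 ℕ.+ k) ℕ.∣ x ℕ.+ 1)
        (trans (cong (2 ^_) (ℕ.*-comm n 2)) (sym (ℕ.^-*-assoc 2 2 n)))
        (im≡-1⇒Q∣2^n+1 (5 ^ (2 ℕ.+ k)) d≡ (n ℕ.* 2) eq))
    pow : ∀ j → n ≡ j ℕ.* 5 → (α d ^ᵣ 5) ^ᵣ j ≡ α d ^ᵣ n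
    pow j n≡ = trans (^-assocʳ (α d) 5 j) (cong (α d ^ᵣ_) (trans (ℕ.*-comm 5 j) (sym n≡)))
    contradiction : ¬ 5 ℕ.∣ n
    contradiction (ℕ.divides j n≡j*5) =
      let t , f∣ = im-α⁵-factor k d≡
          x , y∣ = im-αⁿ∣x²+1 d n eq
      in 3+4t∤x²+1 t x (∣-trans f∣ (∣-trans
           (subst (λ z → im (α d ^ᵣ 5) ∣ im z) (pow j n≡j*5) (im∣im-pow (α d ^ᵣ 5) j)) y∣))

  im≡-1⇒D≡4 : ∀ D m → IsPrimePower (1 ℕ.+ D) → im (α (- + D) ^ᵣ (3 ℕ.+ 4 ℕ.* m)) ≡ -1ℤ → D ≡ 4
  im≡-1⇒D≡4 D m (zero , _ , pr , _) eq = ⊥-elim (¬prime[0] pr)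
  im≡-1⇒D≡4 D m (suc p , zero , pr , () , _) eq
  im≡-1⇒D≡4 D m (suc p , suc k , pr , _ , 1+D≡) eq =
    from-5 k (subst (λ q → 1 ℕ.+ D ≡ q ^ suc k) (p∣5 {n = 1 ℕ.+ 4 ℕ.* m} pr p∣4+r p∣2^+1) 1+D≡)
    where
    d≡ : - + D ≡ 1ℤ - + (1 ℕ.+ D)
    d≡ = e (+ D)
      where
      e : ∀ D → - D ≡ 1ℤ - (1ℤ + D)
      e = solve-∀
    -- The prime minus one divides `suc p ^ suc k` - 1 = D, which divides r + 1.
    p∣4+r : p ℕ.∣ 4 ℕ.+ 4 ℕ.* m
    p∣4+r = let x , pow = 1+km-pow 1 p (suc k) in
      ℕ.∣-trans (ℕ.divides x (ℕ.suc-injective (trans 1+D≡ (trans (cong (λ y → suc y ^ suc k) (sym (ℕ.*-identityˡ p))) pow))))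
        (im≡-1⇒D∣1+r D (3 ℕ.+ 4 ℕ.* m) eq)
    p∣2^+1 : suc p ℕ.∣ 2 ^ (2 ℕ.+ 4 ℕ.* m) ℕ.+ 1
    p∣2^+1 = ℕ.∣-trans (subst (suc p ℕ.∣_) (sym 1+D≡) (ℕ.m∣m*n (suc p ^ k)))
      (im≡-1⇒Q∣2^n+1 (1 ℕ.+ D) d≡ (2 ℕ.+ 4 ℕ.* m) eq)
    from-5 : ∀ k → 1 ℕ.+ D ≡ 5 ^ suc k → D ≡ 4
    from-5 zero    1+D≡5 = ℕ.suc-injective 1+D≡5
    from-5 (suc k) 1+D≡  = ⊥-elim (im≢-1-5^[2+k] k (1 ℕ.+ 2 ℕ.* m)
      (trans d≡ (cong (λ q → 1ℤ - + q) 1+D≡))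
      (subst (λ r → im (α (- + D) ^ᵣ r) ≡ -1ℤ) (e m) eq))
      where
      e : ∀ m → 3 ℕ.+ 4 ℕ.* m ≡ suc ((1 ℕ.+ 2 ℕ.* m) ℕ.* 2)
      e = ℕ.solve-∀

  -- Case analysis on the sign and on r modulo 4.

  -- Modulo 4 the coefficient of αʳ depends only on r modulo 4, with values 0, 1, 2, 3 + d for r =
  -- 0, 1, 2, 3. The conditions on s rule out even r.
  im-α-odd : ∀ e r s → im (α (- (+ 2 * + e)) ^ᵣ r) ≡ s → ¬ + 4 ∣ s → ¬ + 4 ∣ s - + 2 →
    (∃[ m ] r ≡ 1 ℕ.+ 4 ℕ.* m × + 4 ∣ s - 1ℤ) ⊎
    (∃[ m ] r ≡ 3 ℕ.+ 4 ℕ.* m × + 4 ∣ s - (+ 3 - + 2 * + e))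
  im-α-odd e r s im≡s 4∤s 4∤s-2 = by-residue (r divMod 4)
    where
    d = - (+ 2 * + e)
    residue : ∀ c m {z} → α d ^ᵣ c ≡ z → r ≡ c ℕ.+ m ℕ.* 4 → + 4 ∣ s - im z
    residue c m refl r≡ = ≡⇒∣- (trans (sym im≡s) (trans
      (cong (λ i → im (α d ^ᵣ i)) (trans r≡ (cong (c ℕ.+_) (ℕ.*-comm m 4))))
      (proj₂ (Even.im-mod-4 e c m))))
    by-residue : DivMod r 4 →
      (∃[ m ] r ≡ 1 ℕ.+ 4 ℕ.* m × + 4 ∣ s - 1ℤ) ⊎
      (∃[ m ] r ≡ 3 ℕ.+ 4 ℕ.* m × + 4 ∣ s - (+ 3 - + 2 * + e))
    by-residue (result m zero r≡) = ⊥-elim (4∤s (subst (+ 4 ∣_) (+-identityʳ s) (residue 0 m refl r≡)))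
    by-residue (result m (suc zero) r≡) =
      inj₁ (m , trans r≡ (cong suc (ℕ.*-comm m 4)) , residue 1 m (α¹ d) r≡)
    by-residue (result m (suc (suc zero)) r≡) = ⊥-elim (4∤s-2 (residue 2 m (α² d) r≡))
    by-residue (result m (suc (suc (suc zero))) r≡) =
      inj₂ (m , trans r≡ (cong (3 ℕ.+_) (ℕ.*-comm m 4)) , residue 3 m (α³ d) r≡)

  -- For r ≡ 1 modulo 4, `Even.rigid₁` would give r = 1. The class of 3 remains and forces D ≡ 2
  -- modulo 4.
  even-im≡1 : ∀ e r → r > 1 → im (α (- (+ 2 * + e)) ^ᵣ r) ≡ 1ℤ →
    ∃[ m ] r ≡ 3 ℕ.+ 4 ℕ.* m × + 4 ∣ + 2 * + e - + 2
  even-im≡1 e r r>1 eq with im-α-odd e r 1ℤ eq (from-no (+ 4 ∣? 1ℤ)) (from-no (+ 4 ∣? -1ℤ))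
  ... | inj₁ (m , refl , _)   = ⊥-elim (ℕ.<⇒≢ r>1 (sym (cong (λ m → 1 ℕ.+ 4 ℕ.* m) (Even.rigid₁ e m eq))))
  ... | inj₂ (m , r≡ , 4∣)    = m , r≡ , subst (+ 4 ∣_) (lemma (+ e)) 4∣
    where
    lemma : ∀ e → 1ℤ - (+ 3 - + 2 * e) ≡ + 2 * e - + 2
    lemma = solve-∀

  -- The class r ≡ 1 would give -1 ≡ 1 modulo 4; the class of 3 forces D ≡ 0 modulo 4.
  even-im≡-1 : ∀ e r → im (α (- (+ 2 * + e)) ^ᵣ r) ≡ -1ℤ →
    ∃[ m ] r ≡ 3 ℕ.+ 4 ℕ.* m × + 4 ∣ + 2 * + e - + 4
  even-im≡-1 e r eq with im-α-odd e r -1ℤ eq (from-no (+ 4 ∣? -1ℤ)) (from-no (+ 4 ∣? - + 3))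
  ... | inj₁ (_ , _ , 4∣)  = ⊥-elim (from-no (+ 4 ∣? - + 2) 4∣)
  ... | inj₂ (m , r≡ , 4∣) = m , r≡ , subst (+ 4 ∣_) (lemma (+ e)) 4∣
    where
    lemma : ∀ e → -1ℤ - (+ 3 - + 2 * e) ≡ + 2 * e - + 4
    lemma = solve-∀

  -- The value 3 - 2e equals 1 for D = 2 and -1 for D = 4, the two exceptional cases.
  rigid₃-at : ∀ e m {r} → r ≡ 3 ℕ.+ 4 ℕ.* m → im (α (- (+ 2 * + e)) ^ᵣ r) ≡ + 3 + - (+ 2 * + e) → r ≡ 3
  rigid₃-at e m refl eq = cong (λ m → 3 ℕ.+ 4 ℕ.* m) (Even.rigid₃ e m eq)

  im≡±1 : ∀ {D r a} → IsSolution D r a → im (α (- + D) ^ᵣ r) ≡ 1ℤ ⊎ im (α (- + D) ^ᵣ r) ≡ -1ℤ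
  im≡±1 (inj₁ eq) = inj₁ (cong im eq)
  im≡±1 (inj₂ eq) = inj₂ (cong im eq)

  -pos-double : ∀ {n} e → n ≡ 2 ℕ.* e → - + n ≡ - (+ 2 * + e)
  -pos-double e n≡2e = cong -_ (trans (cong +_ n≡2e) (pos-* 2 e))

  4∤-2+4x : ∀ {i} x → i ≡ - + 2 + x * + 4 → ¬ + 4 ∣ i
  4∤-2+4x x refl 4∣i = from-no (+ 4 ∣? - + 2) (∣m+n∣n⇒∣m 4∣i (divides x refl))

  case-2-mod-4 : ∀ D → D % 4 ≡ 2 → ∀ r → r > 1 →
    im (α (- + D) ^ᵣ r) ≡ 1ℤ ⊎ im (α (- + D) ^ᵣ r) ≡ -1ℤ → D ≡ 2 × r ≡ 3
  case-2-mod-4 D D%4≡2 r r>1 =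
    by-quotient (D / 4) (trans (m≡m%n+[m/n]*n D 4) (cong (ℕ._+ D / 4 ℕ.* 4) D%4≡2))
    where
    by-quotient : ∀ q → D ≡ 2 ℕ.+ q ℕ.* 4 →
      im (α (- + D) ^ᵣ r) ≡ 1ℤ ⊎ im (α (- + D) ^ᵣ r) ≡ -1ℤ → D ≡ 2 × r ≡ 3
    by-quotient q refl (inj₂ eq) =
      let _ , _ , 4∣ = even-im≡-1 (1 ℕ.+ 2 ℕ.* q) r
            (subst (λ d → im (α d ^ᵣ r) ≡ -1ℤ) (-pos-double (1 ℕ.+ 2 ℕ.* q) (e₁ q)) eq)
      in ⊥-elim (4∤-2+4x (+ q) (e₂ (+ q) (pos-* 2 q)) 4∣)
      where
      e₁ : ∀ q → 2 ℕ.+ q ℕ.* 4 ≡ 2 ℕ.* (1 ℕ.+ 2 ℕ.* q)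
      e₁ = ℕ.solve-∀
      e₂ : ∀ {y} x → y ≡ + 2 * x → + 2 * (1ℤ + y) - + 4 ≡ - + 2 + x * + 4
      e₂ x refl = e x
        where
        e : ∀ x → + 2 * (1ℤ + + 2 * x) - + 4 ≡ - + 2 + x * + 4
        e = solve-∀
    by-quotient zero refl (inj₁ eq) =
      let m , r≡ , _ = even-im≡1 1 r r>1 eq in refl , rigid₃-at 1 m r≡ eq
    by-quotient q@(suc _) refl (inj₁ eq) = ⊥-elim (ℕ.<⇒≢ r>1 (sym (begin
      r                ≡⟨ 1+pred ⟨
      suc (ℕ.pred r)   ≡⟨ cong suc (rigid-2+4q q (ℕ.pred r) (s≤s z≤n) eq′) ⟩
      1                ∎)))
      where
      1+pred : suc (ℕ.pred r) ≡ r
      1+pred = ℕ.suc-pred r {{ℕ.>-nonZero (ℕ.<-trans (s≤s z≤n) r>1)}}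
      d≡ : - + (2 ℕ.+ q ℕ.* 4) ≡ - (+ 2 + + 4 * + q)
      d≡ = cong (λ x → - (+ 2 + x)) (trans (cong +_ (ℕ.*-comm q 4)) (pos-* 4 q))
      eq′ : im (α (- (+ 2 + + 4 * + q)) ^ᵣ suc (ℕ.pred r)) ≡ 1ℤ
      eq′ = trans (cong₂ (λ d r → im (α d ^ᵣ r)) (sym d≡) 1+pred) eq

  case-0-mod-4 : ∀ D → D % 4 ≡ 0 → IsPrimePower (1 ℕ.+ D) → ∀ r → r > 1 →
    im (α (- + D) ^ᵣ r) ≡ 1ℤ ⊎ im (α (- + D) ^ᵣ r) ≡ -1ℤ → D ≡ 4 × r ≡ 3
  case-0-mod-4 D D%4≡0 prime-power r r>1 = by-sign
    where
    q = D / 4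
    e = 2 ℕ.* q
    d≡ : - + D ≡ - (+ 2 * + e)
    d≡ = -pos-double e (trans (m≡m%n+[m/n]*n D 4) (trans (cong (ℕ._+ q ℕ.* 4) D%4≡0) (e₁ q)))
      where
      e₁ : ∀ q → q ℕ.* 4 ≡ 2 ℕ.* (2 ℕ.* q)
      e₁ = ℕ.solve-∀
    by-sign : im (α (- + D) ^ᵣ r) ≡ 1ℤ ⊎ im (α (- + D) ^ᵣ r) ≡ -1ℤ → D ≡ 4 × r ≡ 3
    by-sign (inj₁ eq) =
      let _ , _ , 4∣ = even-im≡1 e r r>1 (subst (λ d → im (α d ^ᵣ r) ≡ 1ℤ) d≡ eq)
      in ⊥-elim (4∤-2+4x (+ q) (e₂ (+ q) (pos-* 2 q)) 4∣)
      where
      e₂ : ∀ {y} x → y ≡ + 2 * x → + 2 * y - + 2 ≡ - + 2 + x * + 4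
      e₂ x refl = e₃ x
        where
        e₃ : ∀ x → + 2 * (+ 2 * x) - + 2 ≡ - + 2 + x * + 4
        e₃ = solve-∀
    by-sign (inj₂ eq) =
      let m , r≡ , _ = even-im≡-1 e r (subst (λ d → im (α d ^ᵣ r) ≡ -1ℤ) d≡ eq)
          D≡4 = im≡-1⇒D≡4 D m prime-power (subst (λ r → im (α (- + D) ^ᵣ r) ≡ -1ℤ) r≡ eq)
      in D≡4 , rigid₃-at 2 m r≡ (subst (λ D → im (α (- + D) ^ᵣ r) ≡ -1ℤ) D≡4 eq)

open Lucas
open import Defs
open import Data.Integer using (+_; -_)
open import Data.Nat using (ℕ; _+_; _%_; _>_; NonZero; s≤s; z≤n)
open import Data.Nat.Primality using (Prime)
open import Data.Nat.Properties using (*-identityʳ)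
open import Data.Product using (_×_; ∃-syntax; _,_)
open import Data.Sum using (_⊎_; inj₁; inj₂; [_,_]′)
open import Function using (id)
open import Function.Bundles using (_⇔_; mk⇔)
open import Relation.Binary.PropositionalEquality using (_≡_; refl; sym)

prime⇒primePower : ∀ {n} → Prime n → IsPrimePower n
prime⇒primePower {n} pr = n , 1 , pr , s≤s z≤n , sym (*-identityʳ n)

lemma3p2 : ((D : ℕ) → .{{_ : NonZero D}} → D % 4 ≡ 2 →
    (r : ℕ) → r > 1 →
    (∃[ a ] IsSolution D r a) ⇔ (D ≡ 2 × r ≡ 3))
    ×
    ((D : ℕ) → .{{_ : NonZero D}} → D % 4 ≡ 0 → Prime (1 + D) ⊎ IsPrimePower (1 + D) →
    (r : ℕ) → r > 1 →
    (∃[ a ] IsSolution D r a) ⇔ (D ≡ 4 × r ≡ 3))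
lemma3p2 =
  (λ D D%4≡2 r r>1 → mk⇔
    (λ (a , solution) → case-2-mod-4 D D%4≡2 r r>1 (im≡±1 {r = r} {a} solution))
    -- (1 + √-2)³ = -5 + √-2.
    (λ { (refl , refl) → - + 5 , inj₁ refl })) ,
  (λ D D%4≡0 pp r r>1 → mk⇔
    (λ (a , solution) → case-0-mod-4 D D%4≡0 ([ prime⇒primePower , id ]′ pp) r r>1 (im≡±1 {r = r} {a} solution))
    -- (1 + √-4)³ = -11 - √-4.
    (λ { (refl , refl) → - + 11 , inj₂ refl }))
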